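{- There is an online advice strategy for bin covering, namely $\mathsf{DH}^{b+\lg n}_4$ described in the context, that reads $O(b+\log n)$ bits of advice and satisfies, for every input sequence $\sigma$ of length $n$, $$|\mathsf{DH}^{b+\lg n}_4(\sigma)| \ge \frac{2}{3}\,|\mathsf{OPT}(\sigma)| - \frac{173}{60},$$ where $b$ is the number of bits required to represent any rational value in $\sigma$, $|\mathsf{OPT}(\sigma)|$ is the maximum number of bins that can be covered with the items of $\sigma$, and $|\mathsf{DH}^{b+\lg n}_4(\sigma)|$ is the number of bins covered by the strategy.
   Context: Bin covering: given a sequence $\sigma$ of items with rational sizes, each item size $v$ satisfying $0<v<1$, partition the items into bins; the load of a bin is the sum of its item sizes and a bin is covered if its load is at least $1$; the goal is to maximize the number of covered bins. Online: items arrive one by one and each must be irrevocably placed in a bin (existing or newly opened) before the next arrives. Advice model: an oracle knowing the entire input and the strategy writes a bit string on an advice tape which the strategy may read; all advice is written in a self-delimiting encoding $e(s)=u(s)\circ b(s)\circ s$, where $b(s)$ is the binary encoding of the length of $s$ and $u(s)$ is $|b(s)|$ ones followed by a zero; the advice complexity is the number of bits read. Dual Next Fit (DNF) on a stream of items: keep one active bin, put each item into it, and when it becomes covered close it and open a new empty active bin. Let $k=4$. For an integer $2\le t\le k$, an item $v$ is a $t$-item if $1/t\le v<1/(t-1)$; an item $v<1/k$ is small. Let $x_1\ge x_2\ge\dots\ge x_n$ be the items of $\sigma$ sorted in non-increasing order. Strategy $\mathsf{DH}^{b+\lg n}_k$: it first reads from the advice an integer $m$ and the value $x_m$ (the $m$-th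 largest item of $\sigma$). It opens $m$ critical bins, each with an initial virtual load of $x_m$; it also opens one $t$-bin for each $t\in\{2,\dots,k\}$ and one small bin. The virtual load of a critical bin equals the sum of its small items plus either $x_m$ (if it contains no item of size $\ge x_m$ yet) or the actual size of the item of size $\ge x_m$ it contains. When an item $v$ arrives: (1) if $x_m\le v$, place $v$ in the next critical bin that does not yet contain such a (2-)item and update its virtual load; (2) if $1/k\le v<x_m$ and $v$ is a $t$-item, place $v$ in the current $t$-bin using DNF (when it becomes covered, close it and open a new $t$-bin); (3) if $v<1/k$, place $v$ in the next critical bin whose virtual load is still below $1$ and update its virtual load; if all critical bins have virtual load at least $1$, place $v$ in the small bin using DNF (when it becomes covered, close it and open a new small bin). The oracle chooses $m$ by emulating the strategy for every integer $0\le m\le n_2$, where $n_2$ is the number of $2$-items in $\sigma$, and reports (self-delimitingly encoded) a value of $m$ for which the strategy covers as many bins as possible, together with the exact rational value $x_m$. -}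

module Defs where

open import Data.Bool.Base using (Bool; true; false; if_then_else_)
open import Data.Empty using (⊥)
open import Data.Integer.Base using (+_; ∣_∣)
open import Data.List.Base using (List; []; _∷_; _++_; length; map; filter; foldr; replicate; upTo; applyUpTo; zip; head; cartesianProductWith; deduplicate)
import Data.List.Sort
open import Data.List.Extrema.Nat using (max; argmax)
open import Data.Maybe.Base as Maybe using (Maybe; just; nothing; fromMaybe; is-nothing; _<∣>_)
open import Data.Nat.Base using (ℕ; zero; suc; _∸_) renaming (_+_ to _+ℕ_; _*_ to _*ℕ_)
open import Data.Nat.Properties using () renaming (_≟_ to _≟ℕ_)
open import Data.Product.Base using (_×_; _,_; proj₁; proj₂; map₁)
open import Data.Rational.Base using (ℚ; 0ℚ; 1ℚ; _+_; _/_; _≤_; _<_; ↥_; ↧ₙ_)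
open import Data.Rational.Properties using (_≤?_; _<?_; ≤-decTotalOrder)
open import Function.Base using (_∘_)
open import Relation.Binary.Construct.Flip.EqAndOrd using (decTotalOrder)
open import Relation.Binary.Definitions using (DecidableEquality)
open import Relation.Binary.PropositionalEquality using (refl; cong)
open import Relation.Nullary.Decidable using (Dec; yes; no; does; map′; _×-dec_)

module Descending = Data.List.Sort (decTotalOrder ≤-decTotalOrder)

IsSize : ℚ → Set
IsSize v = 0ℚ < v × v < 1ℚ

Packing : Set → Set
Packing Bin = List (Bin × ℚ)

module _ {Bin : Set} (_≟_ : DecidableEquality Bin) where

  load : Bin → Packing Bin → ℚ
  load β p = foldr _+_ 0ℚ (map proj₂ (filter (λ e → proj₁ e ≟ β) p))

  covered : Packing Bin → ℕ
  covered p = length (filter (λ β → 1ℚ ≤? load β p) (deduplicate _≟_ (map proj₁ p)))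

labellings : ℕ → ℕ → List (List ℕ)
labellings n zero    = [] ∷ []
labellings n (suc l) = cartesianProductWith _∷_ (upTo n) (labellings n l)

-- Covered bins are non-empty, so n bins suffice for n items.
OPT : List ℚ → ℕ
OPT σ = max 0 (map (λ ls → covered _≟ℕ_ (zip ls σ)) (labellings n n))
  where n = length σ

Bits : Set
Bits = List Bool

-- Least significant bit first, without leading zeros (so 0 is encoded by []).
increment : Bits → Bits
increment []           = true ∷ []
increment (false ∷ bs) = true ∷ bs
increment (true  ∷ bs) = false ∷ increment bs

binary : ℕ → Bits
binary zero    = []
binary (suc n) = increment (binary n)

value : Bits → ℕ
value []           = 0
value (false ∷ bs) = 2 *ℕ value bs
value (true  ∷ bs) = 1 +ℕ 2 *ℕ value bs

selfDelimiting : Bits → Bits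
selfDelimiting s = u ++ b ++ s
  where
  b = binary (length s)
  u = replicate (length b) true ++ false ∷ []

encodeℕ : ℕ → Bits
encodeℕ = selfDelimiting ∘ binary

-- The sign is dropped: only non-negative values are ever encoded.
encodeℚ : ℚ → Bits
encodeℚ q = encodeℕ ∣ ↥ q ∣ ++ encodeℕ (↧ₙ q)

-- The quantity b: the largest number of bits needed to write numerator and
-- denominator, in lowest terms, of an item.
ratBits : ℚ → ℕ
ratBits q = length (binary ∣ ↥ q ∣) +ℕ length (binary (↧ₙ q))

itemBits : List ℚ → ℕ
itemBits σ = max 0 (map ratBits σ)

-- A reader returns, together with its result, the part of the tape it has
-- not read; it fails when the tape ends too early or is malformed.
Reader : Set → Set
Reader A = Bits → Maybe (A × Bits)

return : ∀ {A} → A → Reader A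
return a tape = just (a , tape)

_>>=_ : ∀ {A B} → Reader A → (A → Reader B) → Reader B
(r >>= f) tape = r tape Maybe.>>= λ (a , rest) → f a rest

readUnary : Reader ℕ
readUnary []             = nothing
readUnary (false ∷ tape) = just (0 , tape)
readUnary (true  ∷ tape) = Maybe.map (map₁ suc) (readUnary tape)

readBits : ℕ → Reader Bits
readBits zero    tape       = just ([] , tape)
readBits (suc l) []         = nothing
readBits (suc l) (b ∷ tape) = Maybe.map (map₁ (b ∷_)) (readBits l tape)

readSelfDelimiting : Reader Bits
readSelfDelimiting = do
  l ← readUnary
  b ← readBits l
  readBits (value b)

readℕ : Reader ℕ
readℕ = do
  s ← readSelfDelimiting
  return (value s)

readℚ : Reader ℚ
readℚ = do
  p ← readℕ
  q ← readℕ
  fraction p q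
  where
  fraction : ℕ → ℕ → Reader ℚ
  fraction p zero    _ = nothing
  fraction p (suc d)   = return (+ p / suc d)

record AdviceStrategy : Set₁ where
  field
    Bin   : Set
    _≟_   : DecidableEquality Bin
    State : Set
    start : Reader State
    place : State → ℚ → Bin × State

  pack : State → List ℚ → Packing Bin
  pack s []      = []
  pack s (v ∷ σ) = (proj₁ (place s v) , v) ∷ pack (proj₂ (place s v)) σ

record Outcome : Set where
  field
    bitsRead    : ℕ
    coveredBins : ℕ

execute : AdviceStrategy → Bits → List ℚ → Maybe Outcome
execute S tape σ = Maybe.map outcome (start tape)
  where
  open AdviceStrategy S
  outcome : State × Bits → Outcome
  outcome (s , rest) = record
    { bitsRead    = length tape ∸ length rest
    ; coveredBins = covered _≟_ (pack s σ)
    }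

_-Item_ : ℕ → ℚ → Set
suc (suc t) -Item v = (+ 1 / suc (suc t)) ≤ v × v < (+ 1 / suc t)
_           -Item v = ⊥

_-item?_ : ∀ t v → Dec (t -Item v)
zero        -item? v = no λ ()
suc zero    -item? v = no λ ()
suc (suc t) -item? v = ((+ 1 / suc (suc t)) ≤? v) ×-dec (v <? (+ 1 / suc t))

-- The t in {2,…,k} for which v is a t-item.  For 0 < v < 1 there is none
-- exactly when v < 1/k, that is, when v is small.
itemType : ℕ → ℚ → Maybe ℕ
itemType k v = head (filter (λ t → t -item? v) (applyUpTo (2 +ℕ_) (k ∸ 1)))

-- State of Dual Next Fit on one stream: number of bins closed so far (which
-- names the active bin) and load of the active bin.
record Active : Set where
  constructor active
  field
    index : ℕ
    level : ℚ

fresh : Active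
fresh = active 0 0ℚ

dualNextFit : ℚ → Active → Active
dualNextFit v (active i l) =
  if does (1ℚ ≤? (l + v)) then active (suc i) 0ℚ else active i (l + v)

record Critical : Set where
  field
    large  : Maybe ℚ   -- the item of size ≥ x_m, once it has arrived
    smalls : ℚ         -- total size of the small items

open Critical

virtualLoad : ℚ → Critical → ℚ
virtualLoad xₘ c = fromMaybe xₘ (large c) + smalls c

data DHBin : Set where
  critical : ℕ → DHBin
  typed    : (t i : ℕ) → DHBin
  small    : ℕ → DHBin

_≟ᴮ_ : DecidableEquality DHBin
critical i ≟ᴮ critical j = map′ (cong critical) (λ { refl → refl }) (i ≟ℕ j)
critical _ ≟ᴮ typed _ _  = no λ ()
critical _ ≟ᴮ small _    = no λ ()
typed _ _  ≟ᴮ critical _ = no λ ()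
typed t i  ≟ᴮ typed u j  = map′ (λ { (refl , refl) → refl }) (λ { refl → refl , refl }) ((t ≟ℕ u) ×-dec (i ≟ℕ j))
typed _ _  ≟ᴮ small _    = no λ ()
small _    ≟ᴮ critical _ = no λ ()
small _    ≟ᴮ typed _ _  = no λ ()
small i    ≟ᴮ small j    = map′ (cong small) (λ { refl → refl }) (i ≟ℕ j)

record DHState : Set where
  field
    xₘ           : ℚ
    criticalBins : List Critical
    typedActive  : ℕ → Active
    smallActive  : Active

open DHState

initial : ℕ → ℚ → DHState
initial m x = record
  { xₘ           = x
  ; criticalBins = replicate m (record { large = nothing ; smalls = 0ℚ })
  ; typedActive  = λ _ → fresh
  ; smallActive  = fresh
  }

updateFirst : {A : Set} → (A → Bool) → (A → A) → List A → Maybe (ℕ × List A)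
updateFirst p f []       = nothing
updateFirst p f (x ∷ xs) =
  if p x then just (0 , f x ∷ xs)
  else Maybe.map (λ (i , ys) → suc i , x ∷ ys) (updateFirst p f xs)

updateCritical : (Critical → Bool) → (Critical → Critical) → DHState → Maybe (DHBin × DHState)
updateCritical p f s =
  Maybe.map (λ (i , cs) → critical i , record s { criticalBins = cs })
            (updateFirst p f (criticalBins s))

placeLarge : DHState → ℚ → Maybe (DHBin × DHState)
placeLarge s v =
  if does (xₘ s ≤? v)
  then updateCritical (λ c → is-nothing (large c)) (λ c → record c { large = just v }) s
  else nothing

placeTyped : DHState → ℚ → ℕ → DHBin × DHState
placeTyped s v t =
  typed t (Active.index (typedActive s t)) ,
  record s { typedActive = λ u → if does (u ≟ℕ t) then dualNextFit v (typedActive s u) else typedActive s u }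

placeSmall : DHState → ℚ → DHBin × DHState
placeSmall s v = fromMaybe
  (small (Active.index (smallActive s)) , record s { smallActive = dualNextFit v (smallActive s) })
  (updateCritical (λ c → does (virtualLoad (xₘ s) c <? 1ℚ)) (λ c → record c { smalls = smalls c + v }) s)

-- If several items have size x_m there can be more than m items of size at
-- least x_m.  Those arriving when every critical bin already has its large
-- item are treated like the other items of their type.
placeDH : ℕ → DHState → ℚ → DHBin × DHState
placeDH k s v = fromMaybe (placeSmall s v)
  (placeLarge s v <∣> Maybe.map (placeTyped s v) (itemType k v))

DH : ℕ → AdviceStrategy
DH k = record
  { Bin   = DHBin
  ; _≟_   = _≟ᴮ_
  ; State = DHState
  ; start = do
      m ← readℕ
      x ← readℚ
      return (initial m x)
  ; place = placeDH k
  }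

nth : List ℚ → ℕ → ℚ
nth []       _       = 1ℚ
nth (x ∷ xs) zero    = x
nth (x ∷ xs) (suc i) = nth xs i

-- The m-th largest item, counting from m = 1.  For m = 0 there are no
-- critical bins and x_0 = 1 exceeds every item.
largest : List ℚ → ℕ → ℚ
largest σ m = nth (1ℚ ∷ Descending.sort σ) m

numberOf2Items : List ℚ → ℕ
numberOf2Items σ = length (filter (2 -item?_) σ)

emulate : ℕ → List ℚ → ℕ → ℕ
emulate k σ m = covered _≟ᴮ_ (AdviceStrategy.pack (DH k) (initial m (largest σ m)) σ)

bestM : ℕ → List ℚ → ℕ
bestM k σ = argmax (emulate k σ) 0 (upTo (suc (numberOf2Items σ)))

oracle : ℕ → List ℚ → Bits
oracle k σ = encodeℕ m ++ encodeℚ (largest σ m)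
  where m = bestM k σ

{-# OPTIONS --safe #-}
module Submission where

-- Give 2-, 3- and 4-items the weights 1/2, 1/3 and 1/4.  In an optimal packing
-- let n be the number of covered bins holding an item of size at least 3/4 and
-- otherwise only small items, and let S be the total size of the small items
-- in the other covered bins.  A bin of the first kind has weight at least 1/2,
-- any other one has weight plus 2/3 of its small items at least 2/3, so OPT
-- satisfies 2/3 OPT ≤ W + n/6 + 2/3 S, where W is the total weight.
--
-- Take the largest m ≤ n with 3m ≤ n + 4S and put d = 1 - x_m ≤ 1/4.  If every
-- small item is truncated at d, a critical bin absorbs at most 2d, while at
-- most m of the n bins own an item above x_m and each other one holds small
-- items of truncated size at least d; the items in S contribute at least 4dS.
-- Hence the small items suffice to cover all m critical bins, and DH covers at
-- least W + m/2 - 23/12 bins.  If m < n, then m/2 ≥ n/6 + 2/3 S - 1/2 and we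
-- are done.  If m = n, then S ≥ n/2, the critical bins use small items of total
-- size at most n/2, and the small items left over fill enough further bins.

open import Data.Bool.Base using (Bool; true; false; if_then_else_)
open import Data.Integer.Base using (+_; -[1+_]; ∣_∣)
import Data.Integer.Base as ℤ
import Data.Integer.Properties as ℤ
open import Data.Fin using (#_)
open import Data.List.Base using (List; []; _∷_; _++_; _ʳ++_; concat; deduplicate; filter; foldr; head; length; map; replicate; upTo; zip)
open import Data.List.Extrema.Nat using (argmax-sel; f[xs]≤f[argmax]; xs≤max)
open import Data.List.Membership.Propositional using (_∈_)
open import Data.List.Membership.Propositional.Properties using (∈-∃++; ∈-++⁺ˡ; ∈-++⁺ʳ; ∈-++⁻; ∈-map⁺; ∈-map⁻; ∈-cartesianProductWith⁻; ∈-filter⁺; ∈-deduplicate⁺; ∈-upTo⁺; ∈-upTo⁻)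
open import Data.List.Properties using (++-assoc; filter-accept; filter-reject; length-++; length-filter; length-map; length-replicate; length-upTo; map-∘; map-id)
open import Data.List.Relation.Binary.Disjoint.Propositional using (Disjoint)
open import Data.List.Relation.Binary.Permutation.Propositional using (_↭_; ↭-sym; refl; prep; swap; trans)
open import Data.List.Relation.Binary.Permutation.Propositional.Properties using (↭-length; ∈-resp-↭)
open import Data.List.Relation.Unary.All as All using (All; []; _∷_)
import Data.List.Relation.Unary.All.Properties as All
open import Data.List.Relation.Unary.AllPairs using (AllPairs; []; _∷_)
open import Data.List.Relation.Unary.Any using (here; there)
open import Data.List.Relation.Unary.Linked.Properties using (Linked⇒AllPairs)
open import Data.List.Relation.Unary.Unique.DecPropositional.Properties using (deduplicate-!)
open import Data.List.Relation.Unary.Unique.Propositional using (Unique)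
import Data.List.Relation.Unary.Unique.Propositional.Properties as Unique
open import Data.Maybe.Base as Maybe using (Maybe; just; nothing; fromMaybe; is-nothing; _<∣>_)
open import Data.Nat.Base using (ℕ) renaming (_≤_ to _≤ℕ_; _+_ to _+ℕ_; _*_ to _*ℕ_)
open import Data.Nat.Base as ℕ using (zero; suc; s≤s; z≤n; s<s⁻¹)
open import Data.Nat.Induction using (<-rec)
open import Data.Nat.Logarithm using (⌈log₂_⌉; ⌈log₂⌉-mono-≤; ⌈log₂2*n⌉≡1+⌈log₂n⌉)
import Data.Nat.Properties as ℕ
import Data.Nat.Solver as ℕ
open import Data.Product.Base using (∃-syntax; _×_; _,_; proj₁; proj₂)
open import Data.Rational.Base using (ℚ; mkℚ; 0ℚ; 1ℚ; ½; _+_; _*_; _-_; -_; _/_; _≤_; _<_; *≤*; *<*; _⊓_; ↥_; ↧ₙ_; toℚᵘ; nonNegative; positive)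
open import Data.Rational.Properties
open import Data.Rational.Solver using (module +-*-Solver)
import Data.Rational.Unnormalised.Base as ℚᵘ
open import Data.Sum.Base as Sum using (_⊎_; inj₁; inj₂)
open import Data.Unit.Base using (⊤; tt)
open import Data.Vec.Base using (Vec; []; _∷_; tabulate)
open import Function.Base using (id; _∘_)
open import Relation.Binary.Definitions using (DecidableEquality)
open import Relation.Binary.PropositionalEquality as ≡ using (_≡_; _≢_; cong; cong₂; subst; subst₂; sym)
open import Relation.Nullary.Decidable using (Dec; yes; no; does; True; toWitness; _×-dec_)
open import Relation.Nullary.Negation using (¬_; contradiction)
open import Relation.Unary using (Decidable)
open +-*-Solver using (Polynomial; var; con; _:+_; _:*_; _:-_; ⟦_⟧; ⟦_⟧↓; prove)
open import Defs

-- The obstacle is waste in the critical bins: the last small item put into one may have size close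
-- to `¼` although the bin lacked next to nothing, so the plain volume of small items does not tell
-- how many critical bins become covered. Truncation caps this waste at `d`, and everything then
-- scales with `d`: covering `m` bins takes at most `2dm`, the packing supplies at least
-- `d(n - m) + 4dS`, and `d` cancels to leave `3m ≤ n + 4S`. Hence `m` can be fixed although `x_m`,
-- and with it `d`, depends on `m`. The factor 4 is `1 / ¼`, as a small item `v` satisfies
-- `min(d, v) ≥ 4dv` for `d ≤ ¼`.
--
-- The threshold `¾` is `3/2 · ½`, the largest size of a 2-item that is still paid for by `3/2` of
-- its weight. The term `m/2` appears because a critical bin is one covered bin that uses up a
-- single 2-item of weight `½`. The constant `23/12 = ½ + ⅔ + ¾` is the weight that can be stranded
-- in the three active typed bins. As the oracle maximises over all `m` up to the number of 2-items,
-- and `n` is at most that number, analysing one suitable `m` is enough.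

private variable A : Set

+-congˡ : ∀ p {q r} → q ≡ r → p + q ≡ p + r
+-congˡ p = cong (λ q → p + q)

-- Linear arithmetic over ℚ

infix 4 _≼_
infixr 5 _⊗_∷_

record Inequality (n : ℕ) : Set where
  constructor _≼_
  field
    lhs rhs : Polynomial n

data Combination (n : ℕ) : Set where
  []    : Combination n
  _⊗_∷_ : ℚ → Inequality n → Combination n → Combination n

difference : ∀ {n} → Inequality n → Polynomial n
difference (l ≼ r) = r :- l

Holds : ∀ {n} → Vec ℚ n → Inequality n → Set
Holds ρ (l ≼ r) = ⟦ l ⟧ ρ ≤ ⟦ r ⟧ ρ

sumOfDifferences : ∀ {n} → Combination n → Polynomial n
sumOfDifferences []           = con 0ℚ
sumOfDifferences (q ⊗ i ∷ is) = con q :* difference i :+ sumOfDifferences is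

NonNegativeWeights : ∀ {n} → Combination n → Set
NonNegativeWeights []           = ⊤
NonNegativeWeights (q ⊗ i ∷ is) = True (0ℚ ≤? q) × NonNegativeWeights is

-- The hypotheses become curried arguments in the order of the certificate, so each use of `linear`
-- lists their proofs row by row.
_⇛_ : ∀ {n} → Combination n → Set → Vec ℚ n → Set
([] ⇛ G)           ρ = G
((q ⊗ i ∷ is) ⇛ G) ρ = Holds ρ i → (is ⇛ G) ρ

<⇒≱ : ∀ {p q} → p < q → ¬ (q ≤ p)
<⇒≱ p<q q≤p = <-irrefl ≡.refl (<-≤-trans p<q q≤p)

p≤q⇒0≤q-p : ∀ {p q} → p ≤ q → 0ℚ ≤ q - p
p≤q⇒0≤q-p {p} {q} p≤q = subst (_≤ q - p) (+-inverseʳ p) (+-monoˡ-≤ (- p) p≤q)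

0≤q-p⇒p≤q : ∀ {p q} → 0ℚ ≤ q - p → p ≤ q
0≤q-p⇒p≤q {p} {q} h = subst₂ _≤_ (+-identityˡ p)
  (prove (p ∷ q ∷ []) (var (# 1) :- var (# 0) :+ var (# 0)) (var (# 1)) ≡.refl) (+-monoˡ-≤ p h)

0≤* : ∀ {p q} → 0ℚ ≤ p → 0ℚ ≤ q → 0ℚ ≤ p * q
0≤* {p} {q} 0≤p 0≤q = subst (_≤ p * q) (*-zeroʳ p) (*-monoˡ-≤-nonNeg p {{nonNegative 0≤p}} 0≤q)

0≤+ : ∀ {p q} → 0ℚ ≤ p → 0ℚ ≤ q → 0ℚ ≤ p + q
0≤+ {p} {q} 0≤p 0≤q = subst (_≤ p + q) (+-identityˡ 0ℚ) (+-mono-≤ 0≤p 0≤q)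

vars : ∀ {n} → Vec (Polynomial n) n
vars = tabulate var

module _ {n : ℕ} (ρ : Vec ℚ n) where

  combine : (c : Combination n) → NonNegativeWeights c → {G : Set} →
            (0ℚ ≤ ⟦ sumOfDifferences c ⟧ ρ → G) → (c ⇛ G) ρ
  combine []                 _ k   = k ≤-refl
  combine (q ⊗ (l ≼ r) ∷ is) (0≤q , w) k h =
    combine is w λ s → k (0≤+ (0≤* (toWitness 0≤q) (p≤q⇒0≤q-p h)) s)

  -- Farkas certificates: the goal follows once its difference is, as a
  -- polynomial, the weighted sum of the differences of the hypotheses.
  linear : (f : Vec (Polynomial n) n → Combination n × Inequality n) →
           let c = proj₁ (f vars) ; g = proj₂ (f vars) in
           {w : NonNegativeWeights c} →
           ⟦ difference g ⟧↓ ρ ≡ ⟦ sumOfDifferences c ⟧↓ ρ → (c ⇛ Holds ρ g) ρ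
  linear f {w} eq = combine (proj₁ (f vars)) w λ s →
    0≤q-p⇒p≤q (subst (0ℚ ≤_)
      (sym (prove ρ (difference (proj₂ (f vars))) (sumOfDifferences (proj₁ (f vars))) eq)) s)

  linear-≡ : (f : Vec (Polynomial n) n → Polynomial n × Polynomial n) →
             let e = proj₁ (f vars) ; e′ = proj₂ (f vars) in
             ⟦ e ⟧↓ ρ ≡ ⟦ e′ ⟧↓ ρ → ⟦ e ⟧ ρ ≡ ⟦ e′ ⟧ ρ
  linear-≡ f = prove ρ (proj₁ (f vars)) (proj₂ (f vars))

-- Abstract, lest unification unfold the gcd computations behind _/_.
abstract
  ι : ℕ → ℚ
  ι n = + n / 1

  ι-def : ∀ n → ι n ≡ + n / 1
  ι-def n = ≡.refl

  ι-+ : ∀ m n → ι (m ℕ.+ n) ≡ ι m + ι n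
  ι-+ m n = toℚᵘ-injective (begin
    toℚᵘ (ι (m ℕ.+ n))             ≈⟨ toℚᵘ-fromℚᵘ _ ⟩
    (+ (m ℕ.+ n) ℚᵘ./ 1)            ≈⟨ ℚᵘ.*≡*
        (cong (ℤ._* + 1) (sym (cong₂ ℤ._+_ (ℤ.*-identityʳ (+ m)) (ℤ.*-identityʳ (+ n))))) ⟩
    (+ m ℚᵘ./ 1) ℚᵘ.+ (+ n ℚᵘ./ 1)   ≈⟨ ℚᵘ.+-cong (toℚᵘ-fromℚᵘ (+ m ℚᵘ./ 1)) (toℚᵘ-fromℚᵘ (+ n ℚᵘ./ 1)) ⟨
    toℚᵘ (ι m) ℚᵘ.+ toℚᵘ (ι n)      ≈⟨ toℚᵘ-homo-+ (ι m) (ι n) ⟨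
    toℚᵘ (ι m + ι n)               ∎)
    where
    import Data.Rational.Unnormalised.Properties as ℚᵘ
    open ℚᵘ.≃-Reasoning

  0≤ι : ∀ n → 0ℚ ≤ ι n
  0≤ι n = nonNegative⁻¹ (ι n) {{normalize-nonNeg n 1}}

ι-0 : ι 0 ≡ 0ℚ
ι-0 = ι-def 0

ι-suc : ∀ n → ι (suc n) ≡ 1ℚ + ι n
ι-suc n = ≡.trans (ι-+ 1 n) (cong (_+ ι n) (ι-def 1))

ι-* : ∀ m n → ι (m ℕ.* n) ≡ ι m * ι n
ι-* zero    n = ≡.trans ι-0 (sym (≡.trans (cong (_* ι n) ι-0) (*-zeroˡ (ι n))))
ι-* (suc m) n = ≡.trans (ι-+ n (m ℕ.* n)) (≡.trans (+-congˡ (ι n) (ι-* m n))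
  (≡.trans (cong (_+ ι m * ι n) (sym (*-identityˡ (ι n))))
    (≡.trans (sym (*-distribʳ-+ (ι n) 1ℚ (ι m))) (cong (_* ι n) (sym (ι-suc m))))))

ι-mono-≤ : ∀ {m n} → m ℕ.≤ n → ι m ≤ ι n
ι-mono-≤ {m} {n} m≤n = subst (ι m ≤_) (≡.trans (sym (ι-+ m _)) (cong ι (ℕ.m+[n∸m]≡n m≤n)))
  (subst (_≤ ι m + ι (n ℕ.∸ m)) (+-identityʳ (ι m)) (+-monoʳ-≤ (ι m) (0≤ι (n ℕ.∸ m))))

ι-cancel-< : ∀ {m n} → ι m < ι n → m ℕ.< n
ι-cancel-< ιm<ιn = ℕ.≰⇒> λ n≤m → <⇒≱ ιm<ιn (ι-mono-≤ n≤m)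

ι-cancel-≤ : ∀ {m n} → ι m ≤ ι n → m ℕ.≤ n
ι-cancel-≤ {m} {n} ιm≤ιn = ℕ.≮⇒≥ λ n<m → <⇒≱ (<-≤-trans (n<1+n′ n) (ι-mono-≤ n<m)) ιm≤ιn
  where
  n<1+n′ : ∀ n → ι n < ι (suc n)
  n<1+n′ n = subst₂ _<_ (+-identityˡ (ι n)) (sym (ι-suc n)) (+-monoˡ-< (ι n) (positive⁻¹ 1ℚ))

-- Sums over lists

total : (A → ℚ) → List A → ℚ
total g []       = 0ℚ
total g (x ∷ xs) = g x + total g xs

total-++ : ∀ (g : A → ℚ) xs ys → total g (xs ++ ys) ≡ total g xs + total g ys
total-++ g []       ys = sym (+-identityˡ _)
total-++ g (x ∷ xs) ys = ≡.trans (+-congˡ (g x) (total-++ g xs ys)) (sym (+-assoc (g x) _ _))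

total-ʳ++ : ∀ (g : A → ℚ) xs ys → total g (xs ʳ++ ys) ≡ total g xs + total g ys
total-ʳ++ g []       ys = sym (+-identityˡ _)
total-ʳ++ g (x ∷ xs) ys = ≡.trans (total-ʳ++ g xs (x ∷ ys))
  (linear-≡ (g x ∷ total g xs ∷ total g ys ∷ [])
    (λ { (a ∷ b ∷ c ∷ []) → b :+ (a :+ c) , a :+ b :+ c }) ≡.refl)

total-cong : ∀ {g h : A → ℚ} → (∀ x → g x ≡ h x) → ∀ xs → total g xs ≡ total h xs
total-cong g≗h []       = ≡.refl
total-cong g≗h (x ∷ xs) = cong₂ _+_ (g≗h x) (total-cong g≗h xs)

total-+ : ∀ (g h : A → ℚ) xs → total (λ x → g x + h x) xs ≡ total g xs + total h xs
total-+ g h []       = sym (+-identityˡ _)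
total-+ g h (x ∷ xs) = ≡.trans (+-congˡ (g x + h x) (total-+ g h xs))
  (linear-≡ (g x ∷ h x ∷ total g xs ∷ total h xs ∷ [])
    (λ { (a ∷ b ∷ c ∷ d ∷ []) → a :+ b :+ (c :+ d) , a :+ c :+ (b :+ d) }) ≡.refl)

total-* : ∀ q (g : A → ℚ) xs → total (λ x → q * g x) xs ≡ q * total g xs
total-* q g []       = sym (*-zeroʳ q)
total-* q g (x ∷ xs) = ≡.trans (+-congˡ (q * g x) (total-* q g xs)) (sym (*-distribˡ-+ q (g x) _))

total-const : ∀ q (xs : List A) → total (λ _ → q) xs ≡ q * ι (length xs)
total-const q []       = sym (≡.trans (cong (q *_) ι-0) (*-zeroʳ q))
total-const q (x ∷ xs) = ≡.trans (cong₂ _+_ (sym (*-identityʳ q)) (total-const q xs))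
  (≡.trans (sym (*-distribˡ-+ q 1ℚ _)) (cong (q *_) (sym (ι-suc (length xs)))))

total-mono : ∀ {g h : A → ℚ} {xs} → All (λ x → g x ≤ h x) xs → total g xs ≤ total h xs
total-mono []           = ≤-refl
total-mono (g≤h ∷ rest) = +-mono-≤ g≤h (total-mono rest)

total-nonNeg : ∀ {g : A → ℚ} {xs} → All (λ x → 0ℚ ≤ g x) xs → 0ℚ ≤ total g xs
total-nonNeg []           = ≤-refl
total-nonNeg (0≤g ∷ rest) = 0≤+ 0≤g (total-nonNeg rest)

total-↭ : ∀ (g : A → ℚ) {xs ys} → xs ↭ ys → total g xs ≡ total g ys
total-↭ g refl          = ≡.refl
total-↭ g (prep x p)    = +-congˡ (g x) (total-↭ g p)
total-↭ g (swap {ys = ys} x y p) = ≡.trans (cong (λ t → g x + (g y + t)) (total-↭ g p))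
  (linear-≡ (g x ∷ g y ∷ total g ys ∷ [])
    (λ { (a ∷ b ∷ c ∷ []) → a :+ (b :+ c) , b :+ (a :+ c) }) ≡.refl)
total-↭ g (trans p q)   = ≡.trans (total-↭ g p) (total-↭ g q)

-- There is no slack: the tail sums to at most `K` times its length, which forces the head up to
-- `K`; the head is at most `K`, which hands the hypothesis on to the tail. This turns a bound
-- summed over all critical bins into a statement about each of them.
total-saturated : ∀ (g : A → ℚ) K {xs} → All (λ x → g x ≤ K) xs →
                  K * ι (length xs) ≤ total g xs → All (λ x → K ≤ g x) xs
total-saturated g K []                       _ = []
total-saturated g K (_∷_ {x} {xs} g≤K rest)  h =
  linear (g x ∷ K ∷ K * ι (length xs) ∷ total g xs ∷ [])
    (λ { (a ∷ K ∷ l ∷ t ∷ []) → (1ℚ ⊗ (K :+ l ≼ a :+ t) ∷ 1ℚ ⊗ (t ≼ l) ∷ []) , (K ≼ a) }) ≡.refl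
    h′ (subst (total g xs ≤_) (total-const K xs) (total-mono rest)) ∷
  total-saturated g K rest
    (linear (g x ∷ K ∷ K * ι (length xs) ∷ total g xs ∷ [])
      (λ { (a ∷ K ∷ l ∷ t ∷ []) → (1ℚ ⊗ (K :+ l ≼ a :+ t) ∷ 1ℚ ⊗ (a ≼ K) ∷ []) , (l ≼ t) }) ≡.refl
      h′ g≤K)
  where
  h′ : K + K * ι (length xs) ≤ g x + total g xs
  h′ = subst (_≤ g x + total g xs)
    (≡.trans (cong (K *_) (ι-suc (length xs)))
      (≡.trans (*-distribˡ-+ K 1ℚ _) (cong (_+ K * ι (length xs)) (*-identityʳ K)))) h

abstract
  -- Being abstract, `indicator P? x` does not unfold in goals, so `indicator-yes` and
  -- `indicator-no` can be used with `rewrite`.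
  indicator : ∀ {P : A → Set} → Decidable P → A → ℚ
  indicator P? x = if does (P? x) then 1ℚ else 0ℚ

  indicator-nonNeg : ∀ {P : A → Set} (P? : Decidable P) x → 0ℚ ≤ indicator P? x
  indicator-nonNeg P? x with does (P? x)
  ... | true  = nonNegative⁻¹ 1ℚ
  ... | false = ≤-refl

  indicator-yes : ∀ {P : A → Set} (P? : Decidable P) {x} → P x → indicator P? x ≡ 1ℚ
  indicator-yes P? {x} px with P? x
  ... | yes _  = ≡.refl
  ... | no ¬px = contradiction px ¬px

  indicator-no : ∀ {P : A → Set} (P? : Decidable P) {x} → ¬ P x → indicator P? x ≡ 0ℚ
  indicator-no P? {x} ¬px with P? x
  ... | yes px = contradiction px ¬px
  ... | no _   = ≡.refl

  indicator-≤1 : ∀ {P : A → Set} (P? : Decidable P) x → indicator P? x ≤ 1ℚ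
  indicator-≤1 P? x with does (P? x)
  ... | true  = ≤-refl
  ... | false = nonNegative⁻¹ 1ℚ

  total-indicator : ∀ {P : A → Set} (P? : Decidable P) xs →
                    total (indicator P?) xs ≡ ι (length (filter P? xs))
  total-indicator P? []       = sym ι-0
  total-indicator P? (x ∷ xs) with does (P? x)
  ... | true  = ≡.trans (+-congˡ (1ℚ) (total-indicator P? xs)) (sym (ι-suc (length (filter P? xs))))
  ... | false = ≡.trans (+-identityˡ _) (total-indicator P? xs)

⊆-Unique⇒length-≤ : ∀ {xs ys : List A} → Unique xs → (∀ {x} → x ∈ xs → x ∈ ys) → length xs ℕ.≤ length ys
⊆-Unique⇒length-≤ {xs = []}     []         _     = z≤n
⊆-Unique⇒length-≤ {xs = x ∷ xs} (x∉ ∷ xs!) xs⊆ys with ∈-∃++ (xs⊆ys (here ≡.refl))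
... | as , bs , ≡.refl = begin
  suc (length xs)                     ≤⟨ s≤s (⊆-Unique⇒length-≤ xs! elsewhere) ⟩
  suc (length (as ++ bs))             ≡⟨ cong suc (length-++ as) ⟩
  suc (length as ℕ.+ length bs)       ≡⟨ ℕ.+-suc (length as) (length bs) ⟨
  length as ℕ.+ suc (length bs)       ≡⟨ length-++ as ⟨
  length (as ++ x ∷ bs)               ∎
  where
  open ℕ.≤-Reasoning
  elsewhere : ∀ {y} → y ∈ xs → y ∈ as ++ bs
  elsewhere y∈xs with ∈-++⁻ as (xs⊆ys (there y∈xs))
  ... | inj₁ y∈as           = ∈-++⁺ˡ y∈as
  ... | inj₂ (here ≡.refl)  = contradiction ≡.refl (All.lookup x∉ y∈xs)
  ... | inj₂ (there y∈bs)   = ∈-++⁺ʳ as y∈bs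

-- Bin contents, loads and covered bins of a packing

module _ {Bin : Set} (_≟_ : DecidableEquality Bin) where

  contents : Bin → Packing Bin → List ℚ
  contents β p = map proj₂ (filter (λ e → proj₁ e ≟ β) p)

  load≡total : ∀ β p → load _≟_ β p ≡ total id (contents β p)
  load≡total β p = foldr≡total (contents β p)
    where
    foldr≡total : ∀ xs → foldr _+_ 0ℚ xs ≡ total id xs
    foldr≡total []       = ≡.refl
    foldr≡total (x ∷ xs) = +-congˡ x (foldr≡total xs)

  load-here : ∀ β v p → load _≟_ β ((β , v) ∷ p) ≡ v + load _≟_ β p
  load-here β v p = cong (foldr _+_ 0ℚ ∘ map proj₂) (filter-accept (λ e → proj₁ e ≟ β) ≡.refl)

  load-there : ∀ {β γ} v p → γ ≢ β → load _≟_ β ((γ , v) ∷ p) ≡ load _≟_ β p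
  load-there v p γ≢β = cong (foldr _+_ 0ℚ ∘ map proj₂) (filter-reject (λ e → proj₁ e ≟ _) γ≢β)

  load-ʳ++ : ∀ β p q → load _≟_ β (p ʳ++ q) ≡ load _≟_ β p + load _≟_ β q
  load-ʳ++ β []            q = sym (+-identityˡ _)
  load-ʳ++ β ((γ , v) ∷ p) q with γ ≟ β
  ... | yes ≡.refl = ≡.trans (load-ʳ++ β p ((β , v) ∷ q)) (≡.trans
        (+-congˡ (load _≟_ β p) (load-here β v q))
        (linear-≡ (v ∷ load _≟_ β p ∷ load _≟_ β q ∷ [])
          (λ { (v ∷ a ∷ b ∷ []) → a :+ (v :+ b) , v :+ a :+ b }) ≡.refl))
  ... | no γ≢β     = ≡.trans (load-ʳ++ β p ((γ , v) ∷ q))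
        (+-congˡ (load _≟_ β p) (load-there v q γ≢β))

  load-≥1⇒∈ : ∀ β p → 1ℚ ≤ load _≟_ β p → β ∈ map proj₁ p
  load-≥1⇒∈ β []            h = contradiction h (<⇒≱ (positive⁻¹ 1ℚ))
  load-≥1⇒∈ β ((γ , v) ∷ p) h with γ ≟ β
  ... | yes ≡.refl = here ≡.refl
  ... | no  _      = there (load-≥1⇒∈ β p h)

  -- A label that does not occur in `p` has load 0, so every bin of `L` is in the list that
  -- `covered` counts.
  covered-≥ : ∀ {L} p → Unique L → All (λ β → 1ℚ ≤ load _≟_ β p) L → length L ℕ.≤ covered _≟_ p
  covered-≥ p L! L≥1 = ⊆-Unique⇒length-≤ L! λ {β} β∈L →
    ∈-filter⁺ (λ β → 1ℚ ≤? load _≟_ β p)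
      (∈-deduplicate⁺ _≟_ (load-≥1⇒∈ β p (All.lookup L≥1 β∈L))) (All.lookup L≥1 β∈L)

  module _ (g : ℚ → ℚ) where

    total-spike : ∀ γ v {L} → Unique L → 0ℚ ≤ g v →
                  total (λ β → if does (γ ≟ β) then g v else 0ℚ) L ≤ g v
    total-spike γ v []                  0≤ = 0≤
    total-spike γ v (_∷_ {β} {L} β∉ L!) 0≤ with γ ≟ β
    ... | no  _      = subst (_≤ g v) (sym (+-identityˡ _)) (total-spike γ v L! 0≤)
    ... | yes ≡.refl = ≤-reflexive (≡.trans (+-congˡ (g v) (outside L β∉)) (+-identityʳ (g v)))
      where
      outside : ∀ L → All (γ ≢_) L → total (λ β → if does (γ ≟ β) then g v else 0ℚ) L ≡ 0ℚ
      outside []      []        = ≡.refl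
      outside (β ∷ L) (γ≢β ∷ h) with γ ≟ β
      ... | yes γ≡β = contradiction γ≡β γ≢β
      ... | no  _   = ≡.trans (+-identityˡ _) (outside L h)

    -- An item counts for at most one bin, since `L` has no repetitions, and for none if its bin is
    -- missing from `L`; nonnegativity lets the latter items be dropped.
    total-contents : ∀ {L} p → Unique L → All (λ v → 0ℚ ≤ g v) (map proj₂ p) →
                     total (λ β → total g (contents β p)) L ≤ total g (map proj₂ p)
    total-contents {L} []            L! []           =
      ≤-reflexive (≡.trans (total-const 0ℚ L) (*-zeroˡ (ι (length L))))
    total-contents {L} ((γ , v) ∷ p) L! (0≤gv ∷ 0≤g) = begin
      total (λ β → total g (contents β ((γ , v) ∷ p))) L
        ≡⟨ total-cong split L ⟩
      total (λ β → (if does (γ ≟ β) then g v else 0ℚ) + total g (contents β p)) L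
        ≡⟨ total-+ _ _ L ⟩
      total (λ β → if does (γ ≟ β) then g v else 0ℚ) L + total (λ β → total g (contents β p)) L
        ≤⟨ +-mono-≤ (total-spike γ v L! 0≤gv) (total-contents p L! 0≤g) ⟩
      g v + total g (map proj₂ p) ∎
      where
      open ≤-Reasoning
      split : ∀ β → total g (contents β ((γ , v) ∷ p)) ≡
              (if does (γ ≟ β) then g v else 0ℚ) + total g (contents β p)
      split β with γ ≟ β
      ... | yes ≡.refl = ≡.refl
      ... | no γ≢β     = sym (+-identityˡ _)

OPT-packing : ∀ σ → ∃[ p ] (map proj₂ p ≡ σ × OPT σ ℕ.≤ covered ℕ._≟_ p)
OPT-packing σ
  with argmax-sel id 0 (map (λ ls → covered ℕ._≟_ (zip ls σ)) (labellings (length σ) (length σ)))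
-- The default value 0 of the maximum comes without a labelling; any packing of `σ` will do then.
... | inj₁ OPT≡0 = map (0 ,_) σ , ≡.trans (sym (map-∘ σ)) (map-id σ) , ℕ.≤-trans (ℕ.≤-reflexive OPT≡0) z≤n
... | inj₂ OPT∈  with ∈-map⁻ (λ ls → covered ℕ._≟_ (zip ls σ)) OPT∈
...   | ls , ls∈ , OPT≡ = zip ls σ , items (length σ) ls σ ls∈ ≡.refl , ℕ.≤-reflexive OPT≡
  where
  items : ∀ {n} l ls σ → ls ∈ labellings n l → l ≡ length σ → map proj₂ (zip ls σ) ≡ σ
  items l       ls       []      _   _  = nothing-left ls
    where
    nothing-left : ∀ ls → map proj₂ (zip {B = ℚ} ls []) ≡ []
    nothing-left []      = ≡.refl
    nothing-left (_ ∷ _) = ≡.refl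
  items {n} (suc l) ls (v ∷ σ) ls∈ eq with ∈-cartesianProductWith⁻ _∷_ (upTo n) (labellings n l) ls∈
  ... | b , bs , _ , bs∈ , ≡.refl = cong (v ∷_) (items l bs σ bs∈ (ℕ.suc-injective eq))

-- Item types and their weights

¼ ⅓ ⅔ ¾ : ℚ
¼ = + 1 / 4
⅓ = + 1 / 3
⅔ = + 2 / 3
¾ = + 3 / 4

data Kind (v : ℚ) : Maybe ℕ → Set where
  two   : ½ ≤ v → v < 1ℚ → Kind v (just 2)
  three : ⅓ ≤ v → v < ½  → Kind v (just 3)
  four  : ¼ ≤ v → v < ⅓  → Kind v (just 4)
  tiny  : 0ℚ < v → v < ¼ → Kind v nothing

kind : ∀ {v} → IsSize v → Kind v (itemType 4 v)
kind {v} (0<v , v<1) with ½ ≤? v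
... | yes ½≤v = subst (Kind v) (sym (cong head
        (filter-accept (_-item? v) {x = 2} {xs = 3 ∷ 4 ∷ []} (½≤v , v<1))))
        (two ½≤v v<1)
... | no ½≰v with ⅓ ≤? v
...   | yes ⅓≤v = subst (Kind v) (sym (cong head (≡.trans
          (filter-reject (_-item? v) {x = 2} {xs = 3 ∷ 4 ∷ []} (½≰v ∘ proj₁))
          (filter-accept (_-item? v) {x = 3} {xs = 4 ∷ []} (⅓≤v , ≰⇒> ½≰v)))))
          (three ⅓≤v (≰⇒> ½≰v))
...   | no ⅓≰v with ¼ ≤? v
...     | yes ¼≤v = subst (Kind v) (sym (cong head (≡.trans
            (filter-reject (_-item? v) {x = 2} {xs = 3 ∷ 4 ∷ []} (½≰v ∘ proj₁)) (≡.trans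
            (filter-reject (_-item? v) {x = 3} {xs = 4 ∷ []} (⅓≰v ∘ proj₁))
            (filter-accept (_-item? v) {x = 4} {xs = []} (¼≤v , ≰⇒> ⅓≰v))))))
            (four ¼≤v (≰⇒> ⅓≰v))
...     | no ¼≰v = subst (Kind v) (sym (cong head (≡.trans
            (filter-reject (_-item? v) {x = 2} {xs = 3 ∷ 4 ∷ []} (½≰v ∘ proj₁)) (≡.trans
            (filter-reject (_-item? v) {x = 3} {xs = 4 ∷ []} (⅓≰v ∘ proj₁))
            (filter-reject (_-item? v) {x = 4} {xs = []} (¼≰v ∘ proj₁))))))
            (tiny 0<v (≰⇒> ¼≰v))

weightOf : Maybe ℕ → ℚ
weightOf (just 2) = ½
weightOf (just 3) = ⅓
weightOf (just 4) = ¼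
weightOf _        = 0ℚ

countOf : ℕ → Maybe ℕ → ℚ
countOf t (just u) = if does (u ℕ.≟ t) then 1ℚ else 0ℚ
countOf t nothing  = 0ℚ

ifSmall : Maybe ℕ → ℚ → ℚ
ifSmall nothing  q = q
ifSmall (just _) q = 0ℚ

weight smallPart : ℚ → ℚ
weight v    = weightOf (itemType 4 v)
smallPart v = ifSmall (itemType 4 v) v

isType : ℕ → ℚ → ℚ
isType t v = countOf t (itemType 4 v)

truncated : ℚ → ℚ → ℚ
truncated d v = ifSmall (itemType 4 v) (d ⊓ v)

-- Both versions occur because several items may equal `x_m`: at least `m` items have size at least
-- `x_m`, while at most `m` lie strictly above it.
atLeast above : ℚ → ℚ → ℚ
atLeast x = indicator (x ≤?_)
above   x = indicator (x <?_)

≤! : ∀ {p q} {p≤q : True (p ≤? q)} → p ≤ q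
≤! {p≤q = p≤q} = toWitness p≤q

weight-types : ∀ {v} → IsSize v → weight v ≡ ½ * isType 2 v + ⅓ * isType 3 v + ¼ * isType 4 v
weight-types {v} size with itemType 4 v | kind size
... | .(just 2) | two _ _   = ≡.refl
... | .(just 3) | three _ _ = ≡.refl
... | .(just 4) | four _ _  = ≡.refl
... | .nothing  | tiny _ _  = ≡.refl

weight-nonNeg : ∀ {v} → IsSize v → 0ℚ ≤ weight v
weight-nonNeg {v} size with itemType 4 v | kind size
... | .(just 2) | two _ _   = ≤!
... | .(just 3) | three _ _ = ≤!
... | .(just 4) | four _ _  = ≤!
... | .nothing  | tiny _ _  = ≤!

smallPart-nonNeg : ∀ {v} → IsSize v → 0ℚ ≤ smallPart v
smallPart-nonNeg {v} size with itemType 4 v | kind size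
... | .(just 2) | two _ _    = ≤!
... | .(just 3) | three _ _  = ≤!
... | .(just 4) | four _ _   = ≤!
... | .nothing  | tiny 0<v _ = <⇒≤ 0<v

truncated-nonNeg : ∀ {d v} → 0ℚ ≤ d → IsSize v → 0ℚ ≤ truncated d v
truncated-nonNeg {d} {v} 0≤d size with itemType 4 v | kind size
... | .(just 2) | two _ _    = ≤!
... | .(just 3) | three _ _  = ≤!
... | .(just 4) | four _ _   = ≤!
... | .nothing  | tiny 0<v _ = ⊓-glb 0≤d (<⇒≤ 0<v)

-- Meant for bins that hold an item of size at least `¾` and a second non-small one: summing gives
-- weight at least `2 · ¼ + ¼ = ¾`, more than the required `⅔`.
nonsmall-weight : ∀ {v} → IsSize v → ¼ * atLeast ¼ v + ¼ * atLeast ¾ v ≤ weight v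
nonsmall-weight {v} size with itemType 4 v | kind size
... | .(just 2) | two _ _   = ≤-trans (+-mono-≤ (*-monoˡ-≤-nonNeg ¼ (indicator-≤1 (¼ ≤?_) v))
    (*-monoˡ-≤-nonNeg ¼ (indicator-≤1 (¾ ≤?_) v))) ≤!
... | .(just 3) | three _ v<½ rewrite indicator-no (¾ ≤?_) (<⇒≱ (<-≤-trans v<½ (≤! {½} {¾}))) =
  ≤-trans (+-monoˡ-≤ (¼ * 0ℚ) (*-monoˡ-≤-nonNeg ¼ (indicator-≤1 (¼ ≤?_) v))) ≤!
... | .(just 4) | four _ v<⅓ rewrite indicator-no (¾ ≤?_) (<⇒≱ (<-≤-trans v<⅓ (≤! {⅓} {¾}))) =
  ≤-trans (+-monoˡ-≤ (¼ * 0ℚ) (*-monoˡ-≤-nonNeg ¼ (indicator-≤1 (¼ ≤?_) v))) ≤!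
... | .nothing  | tiny _ v<¼ rewrite indicator-no (¾ ≤?_) (<⇒≱ (<-≤-trans v<¼ (≤! {¼} {¾}))) | indicator-no
    (¼ ≤?_) (<⇒≱ v<¼) = ≤!

big-weight : ∀ {v} → IsSize v → ½ * atLeast ¾ v ≤ weight v
big-weight {v} size with itemType 4 v | kind size
... | .(just 2) | two _ _   = ≤-trans (*-monoˡ-≤-nonNeg ½ (indicator-≤1 (¾ ≤?_) v)) ≤!
... | .(just 3) | three _ v<½ rewrite indicator-no (¾ ≤?_) (<⇒≱ (<-≤-trans v<½ (≤! {½} {¾}))) = ≤!
... | .(just 4) | four _ v<⅓ rewrite indicator-no (¾ ≤?_) (<⇒≱ (<-≤-trans v<⅓ (≤! {⅓} {¾}))) = ≤!
... | .nothing  | tiny _ v<¼ rewrite indicator-no (¾ ≤?_) (<⇒≱ (<-≤-trans v<¼ (≤! {¼} {¾}))) = ≤!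

-- The factor `3/2` is exact for 3-items, as `½ = 3/2 · ⅓`, and generous for 4-items, as `⅓ < 3/8`.
-- It pays for 2-items up to `3/2 · ½ = ¾`; the indicator takes care of the larger ones.
size-≤-weight : ∀ {v} → IsSize v → v ≤ + 3 / 2 * weight v + smallPart v + atLeast ¾ v
size-≤-weight {v} size with itemType 4 v | kind size
... | .(just 3) | three _ v<½ = ≤-trans (<⇒≤ v<½)
    (+-mono-≤ (≤! {½} {+ 3 / 2 * ⅓ + 0ℚ}) (indicator-nonNeg (¾ ≤?_) v))
... | .(just 4) | four _ v<⅓  = ≤-trans (<⇒≤ v<⅓)
    (+-mono-≤ (≤! {⅓} {+ 3 / 2 * ¼ + 0ℚ}) (indicator-nonNeg (¾ ≤?_) v))
... | .nothing  | tiny _ v<¼  = subst (_≤ 0ℚ + v + atLeast ¾ v) (≡.trans (+-identityʳ _) (+-identityˡ v))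
    (+-monoʳ-≤ (0ℚ + v) (indicator-nonNeg (¾ ≤?_) v))
... | .(just 2) | two _ v<1 with ¾ ≤? v
...   | yes ¾≤v rewrite indicator-yes (¾ ≤?_) ¾≤v = ≤-trans (<⇒≤ v<1) ≤!
...   | no  ¾≰v rewrite indicator-no (¾ ≤?_) ¾≰v = ≤-trans (<⇒≤ (≰⇒> ¾≰v)) ≤!

nonsmall-≤-above : ∀ {x v} → ¾ ≤ x → ¼ ≤ v → v < 1ℚ → v ≤ x * atLeast ¼ v + 0ℚ + above x v
nonsmall-≤-above {x} {v} ¾≤x ¼≤v v<1 rewrite indicator-yes (¼ ≤?_) ¼≤v with x <? v
... | yes x<v rewrite indicator-yes (x <?_) x<v = linear (x ∷ v ∷ [])
  (λ { (x ∷ v ∷ []) → (1ℚ ⊗ (v ≼ con 1ℚ) ∷ 1ℚ ⊗ (con ¾ ≼ x) ∷ 1ℚ ⊗ (con 0ℚ ≼ con ¾) ∷ []) ,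
    (v ≼ x :* con 1ℚ :+ con 0ℚ :+ con 1ℚ) }) ≡.refl (<⇒≤ v<1) ¾≤x ≤!
... | no  x≮v rewrite indicator-no (x <?_) x≮v = linear (x ∷ v ∷ [])
  (λ { (x ∷ v ∷ []) → (1ℚ ⊗ (v ≼ x) ∷ []) , (v ≼ x :* con 1ℚ :+ con 0ℚ :+ con 0ℚ) }) ≡.refl (≮⇒≥ x≮v)

-- Summed over a covered bin with a single non-small item and nothing above `x`, this reads
-- `1 ≤ x + s`, so the small items there have total size `s ≥ 1 - x`.
size-≤-above : ∀ {x v} → ¾ ≤ x → IsSize v → v ≤ x * atLeast ¼ v + smallPart v + above x v
size-≤-above {x} {v} ¾≤x size with itemType 4 v | kind size
... | .(just 2) | two ½≤v v<1   = nonsmall-≤-above ¾≤x (≤-trans ≤! ½≤v) v<1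
... | .(just 3) | three ⅓≤v v<½ = nonsmall-≤-above ¾≤x (≤-trans ≤! ⅓≤v) (<-≤-trans v<½ ≤!)
... | .(just 4) | four ¼≤v v<⅓  = nonsmall-≤-above ¾≤x ¼≤v (<-≤-trans v<⅓ ≤!)
... | .nothing  | tiny _ v<¼    rewrite indicator-no (¼ ≤?_) (<⇒≱ v<¼) =
  linear (x ∷ v ∷ above x v ∷ [])
    (λ { (x ∷ v ∷ a ∷ []) → (1ℚ ⊗ (con 0ℚ ≼ a) ∷ []) , (v ≼ x :* con 0ℚ :+ v :+ a) }) ≡.refl
    (indicator-nonNeg (x <?_) v)

-- Truncating at d ≤ ¼ loses at most the factor d / ¼, small items being below ¼.
truncated-≥ : ∀ {d v} → 0ℚ ≤ d → d ≤ ¼ → IsSize v → + 4 / 1 * d * smallPart v ≤ truncated d v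
truncated-≥ {d} {v} 0≤d d≤¼ size with itemType 4 v | kind size
... | .(just 2) | two _ _      = ≤-reflexive (*-zeroʳ (+ 4 / 1 * d))
... | .(just 3) | three _ _    = ≤-reflexive (*-zeroʳ (+ 4 / 1 * d))
... | .(just 4) | four _ _     = ≤-reflexive (*-zeroʳ (+ 4 / 1 * d))
... | .nothing  | tiny 0<v v<¼ = ⊓-glb
  (linear (d ∷ v ∷ d * (¼ - v) ∷ []) (λ { (d ∷ v ∷ e ∷ []) →
    (+ 4 / 1 ⊗ (con 0ℚ ≼ d :* (con ¼ :- v)) ∷ []) , (con (+ 4 / 1) :* d :* v ≼ d) }) ≡.refl
    (0≤* 0≤d (p≤q⇒0≤q-p (<⇒≤ v<¼))))
  (linear (d ∷ v ∷ []) (λ { (d ∷ v ∷ []) →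
    (+ 4 / 1 ⊗ (con 0ℚ ≼ v :* (con ¼ :- d)) ∷ []) , (con (+ 4 / 1) :* d :* v ≼ v) }) ≡.refl
    (0≤* (<⇒≤ 0<v) (p≤q⇒0≤q-p d≤¼)))

total-truncated : ∀ {d I} → 0ℚ ≤ d → All IsSize I → d ≤ total smallPart I → d ≤ total (truncated d) I
total-truncated {d} {I} 0≤d sizes d≤ with dichotomy I sizes
  where
  -- Either nothing has been truncated, or a single truncated item suffices.
  dichotomy : ∀ I → All IsSize I → total smallPart I ≤ total (truncated d) I ⊎ d ≤ total (truncated d) I
  dichotomy []      []             = inj₁ ≤-refl
  dichotomy (v ∷ I) (size ∷ sizes) with dichotomy I sizes
  ... | inj₂ d≤T = inj₂ (subst (_≤ truncated d v + total (truncated d) I) (+-identityˡ d)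
                     (+-mono-≤ (truncated-nonNeg 0≤d size) d≤T))
  ... | inj₁ S≤T with ≤-total d v
  ...   | inj₂ v≤d = inj₁ (+-mono-≤ part S≤T)
    where
    part : smallPart v ≤ truncated d v
    part with itemType 4 v
    ... | just _  = ≤-refl
    ... | nothing = ⊓-glb v≤d ≤-refl
  ...   | inj₁ d≤v with itemType 4 v
  ...     | just _  = inj₁ (+-monoʳ-≤ 0ℚ S≤T)
  ...     | nothing = inj₂ (subst (_≤ d ⊓ v + total (truncated d) I) (+-identityʳ d)
                        (+-mono-≤ (⊓-glb ≤-refl d≤v) (total-nonNeg (All.map (truncated-nonNeg 0≤d) sizes))))
... | inj₁ S≤T = ≤-trans d≤ S≤T
... | inj₂ d≤T = d≤T

-- Covered bins that are not of this form reach ⅔ of a bin without critical bins.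
OneBig : List ℚ → Set
OneBig I = 1 ℕ.≤ length (filter (¾ ≤?_) I) × length (filter (¼ ≤?_) I) ℕ.≤ 1

abstract
  oneBig? : Decidable OneBig
  oneBig? I = (1 ℕ.≤? length (filter (¾ ≤?_) I)) ×-dec (length (filter (¼ ≤?_) I) ℕ.≤? 1)

smallRest : List ℚ → ℚ
smallRest I = if does (oneBig? I) then 0ℚ else total smallPart I

count-≥ : ∀ {P : ℚ → Set} (P? : Decidable P) I {n} → n ℕ.≤ length (filter P? I) →
    ι n ≤ total (indicator P?) I
count-≥ P? I {n} n≤ = subst (ι n ≤_) (sym (total-indicator P? I)) (ι-mono-≤ n≤)

count-≤ : ∀ {P : ℚ → Set} (P? : Decidable P) I {n} → length (filter P? I) ℕ.≤ n →
    total (indicator P?) I ≤ ι n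
count-≤ P? I {n} ≤n = subst (_≤ ι n) (sym (total-indicator P? I)) (ι-mono-≤ ≤n)

-- Bounds for the contents of a single bin

module _ {I : List ℚ} (sizes : All IsSize I) where

  weight-≥-nonsmall : ¼ * total (atLeast ¼) I + ¼ * total (atLeast ¾) I ≤ total weight I
  weight-≥-nonsmall = subst (_≤ total weight I)
    (≡.trans (total-+ (λ v → ¼ * atLeast ¼ v) (λ v → ¼ * atLeast ¾ v) I)
      (cong₂ _+_ (total-* ¼ (atLeast ¼) I) (total-* ¼ (atLeast ¾) I)))
    (total-mono (All.map nonsmall-weight sizes))

  weight-≥-big : ½ * total (atLeast ¾) I ≤ total weight I
  weight-≥-big = subst (_≤ total weight I) (total-* ½ (atLeast ¾) I) (total-mono (All.map big-weight sizes))

  load-≤-weight : total id I ≤ + 3 / 2 * total weight I + total smallPart I + total (atLeast ¾) I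
  load-≤-weight = subst (total id I ≤_)
    (≡.trans (total-+ (λ v → + 3 / 2 * weight v + smallPart v) (atLeast ¾) I)
      (cong (_+ total (atLeast ¾) I) (≡.trans (total-+ (λ v → + 3 / 2 * weight v) smallPart I)
        (cong (_+ total smallPart I) (total-* (+ 3 / 2) weight I)))))
    (total-mono (All.map size-≤-weight sizes))

  load-≤-above : ∀ {x} → ¾ ≤ x →
    total id I ≤ x * total (atLeast ¼) I + total smallPart I + total (above x) I
  load-≤-above {x} ¾≤x = subst (total id I ≤_)
    (≡.trans (total-+ (λ v → x * atLeast ¼ v + smallPart v) (above x) I)
      (cong (_+ total (above x) I) (≡.trans (total-+ (λ v → x * atLeast ¼ v) smallPart I)
        (cong (_+ total smallPart I) (total-* x (atLeast ¼) I)))))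
    (total-mono (All.map (size-≤-above ¾≤x) sizes))

  total-truncated-≥ : ∀ {d} → 0ℚ ≤ d → d ≤ ¼ → + 4 / 1 * d * total smallPart I ≤ total (truncated d) I
  total-truncated-≥ {d} 0≤d d≤¼ = subst (_≤ total (truncated d) I) (total-* (+ 4 / 1 * d) smallPart I)
    (total-mono (All.map (truncated-≥ 0≤d d≤¼) sizes))

  0≤small : 0ℚ ≤ total smallPart I
  0≤small = total-nonNeg (All.map smallPart-nonNeg sizes)

  0≤above : ∀ x → 0ℚ ≤ total (above x) I
  0≤above x = total-nonNeg (All.universal (indicator-nonNeg (x <?_)) I)

  smallRest-nonNeg : 0ℚ ≤ smallRest I
  smallRest-nonNeg with does (oneBig? I)
  ... | true  = ≤-refl
  ... | false = 0≤small

  smallRest-≤ : smallRest I ≤ total smallPart I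
  smallRest-≤ with does (oneBig? I)
  ... | true  = 0≤small
  ... | false = ≤-refl

  oneBig-≤ : indicator oneBig? I ≤ total (atLeast ¾) I
  oneBig-≤ with oneBig? I
  ... | yes one rewrite indicator-yes oneBig? {I} one =
      subst (_≤ total (atLeast ¾) I) (ι-def 1) (count-≥ (¾ ≤?_) I (proj₁ one))
  ... | no ¬one rewrite indicator-no oneBig? {I} ¬one =
      total-nonNeg (All.universal (indicator-nonNeg (¾ ≤?_)) I)

  module _ (full : 1ℚ ≤ total id I) where

    -- Without an item of size at least `¾`, `load-≤-weight` reads `1 ≤ 3/2 w + s` and is scaled by
    -- `⅔`. With such an item, failing `OneBig` means a second non-small item, and the weight alone
    -- is at least `¾`.
    weight-rest : ¬ OneBig I → ⅔ ≤ total weight I + ⅔ * total smallPart I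
    weight-rest ¬one with 1 ℕ.≤? length (filter (¾ ≤?_) I)
    ... | no none = linear (total weight I ∷ total smallPart I ∷ total (atLeast ¾) I ∷ total id I ∷ [])
        (λ { (w ∷ s ∷ b ∷ l ∷ []) →
          (⅔ ⊗ (con 1ℚ ≼ l) ∷ ⅔ ⊗ (l ≼ con (+ 3 / 2) :* w :+ s :+ b) ∷ ⅔ ⊗ (b ≼ con 0ℚ) ∷ []) ,
          (con ⅔ ≼ w :+ con ⅔ :* s) }) ≡.refl
        full load-≤-weight (subst (total (atLeast ¾) I ≤_) ι-0 (count-≤ (¾ ≤?_) I (ℕ.≤-pred (ℕ.≰⇒> none))))
    ... | yes some = linear (total weight I ∷ total smallPart I ∷ total (atLeast ¾) I ∷ total (atLeast ¼)
        I ∷ [])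
        (λ { (w ∷ s ∷ b ∷ c ∷ []) →
          (1ℚ ⊗ (con ¼ :* c :+ con ¼ :* b ≼ w) ∷ ¼ ⊗ (con 1ℚ ≼ b) ∷ ¼ ⊗ (con (+ 2 / 1) ≼ c) ∷
           ⅔ ⊗ (con 0ℚ ≼ s) ∷ 1ℚ ⊗ (con ⅔ ≼ con ¾) ∷ []) ,
          (con ⅔ ≼ w :+ con ⅔ :* s) }) ≡.refl
        weight-≥-nonsmall
        (subst (_≤ total (atLeast ¾) I) (ι-def 1) (count-≥ (¾ ≤?_) I some))
        (subst (_≤ total (atLeast ¼) I) (ι-def 2) (count-≥ (¼ ≤?_) I (ℕ.≰⇒> λ few → ¬one (some , few))))
        0≤small ≤!

    -- A `OneBig` bin is only guaranteed weight `½`; the `1/6` tops it up to `⅔` and is the source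
    -- of the term `n/6`.
    weight-bin : ⅔ ≤ total weight I + + 1 / 6 * indicator oneBig? I + ⅔ * smallRest I
    weight-bin with oneBig? I
    ... | yes one rewrite indicator-yes oneBig? {I} one = linear (total weight I ∷ total (atLeast ¾) I ∷ [])
        (λ { (w ∷ b ∷ []) →
          (1ℚ ⊗ (con ½ :* b ≼ w) ∷ ½ ⊗ (con 1ℚ ≼ b) ∷ []) ,
          (con ⅔ ≼ w :+ con (+ 1 / 6) :* con 1ℚ :+ con ⅔ :* con 0ℚ) }) ≡.refl
        weight-≥-big (subst (_≤ total (atLeast ¾) I) (ι-def 1) (count-≥ (¾ ≤?_) I (proj₁ one)))
    ... | no ¬one rewrite indicator-no oneBig? {I} ¬one = linear (total weight I ∷ total smallPart I ∷ [])
        (λ { (w ∷ s ∷ []) → (1ℚ ⊗ (con ⅔ ≼ w :+ con ⅔ :* s) ∷ []) ,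
          (con ⅔ ≼ w :+ con (+ 1 / 6) :* con 0ℚ :+ con ⅔ :* s) }) ≡.refl
        (weight-rest ¬one)

    oneBig-small : ∀ {x} → ¾ ≤ x → OneBig I → total (above x) I ≤ 0ℚ → 1ℚ - x ≤ total smallPart I
    oneBig-small {x} ¾≤x (_ , few) none =
      linear (x ∷ x * total (atLeast ¼) I ∷ total smallPart I ∷ total (above x) I ∷ total id I ∷ [])
        (λ { (x ∷ xc ∷ s ∷ a ∷ l ∷ []) →
          (1ℚ ⊗ (con 1ℚ ≼ l) ∷ 1ℚ ⊗ (l ≼ xc :+ s :+ a) ∷ 1ℚ ⊗ (a ≼ con 0ℚ) ∷ 1ℚ ⊗ (xc ≼ x :* con 1ℚ) ∷ []) ,
          (con 1ℚ :- x ≼ s) }) ≡.refl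
        full (load-≤-above ¾≤x) none
        (*-monoˡ-≤-nonNeg x {{nonNegative (≤-trans ≤! ¾≤x)}}
          (subst (total (atLeast ¼) I ≤_) (ι-def 1) (count-≤ (¼ ≤?_) I few)))

    -- The term `d * total (above x) I` is a credit: a `OneBig` bin with an item above `x` may hold
    -- hardly any small items and is paid for by it. A `OneBig` bin without such an item needs small
    -- items of total size `d`, which remain worth `d` after truncation.
    truncated-bin : ∀ {x} → ¾ ≤ x → x ≤ 1ℚ → let d = 1ℚ - x in
      d * indicator oneBig? I + + 4 / 1 * d * smallRest I ≤ total (truncated d) I + d * total (above x) I
    truncated-bin {x} ¾≤x x≤1 with oneBig? I
    ... | no ¬one rewrite indicator-no oneBig? {I} ¬one =
      linear (1ℚ - x ∷ total smallPart I ∷ total (truncated (1ℚ - x)) I ∷ total (above x) I ∷ [])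
        (λ { (d ∷ s ∷ t ∷ a ∷ []) →
          (1ℚ ⊗ (con (+ 4 / 1) :* d :* s ≼ t) ∷ 1ℚ ⊗ (con 0ℚ ≼ d :* a) ∷ []) ,
          (d :* con 0ℚ :+ con (+ 4 / 1) :* d :* s ≼ t :+ d :* a) }) ≡.refl
        (total-truncated-≥ 0≤d d≤¼) (0≤* 0≤d (0≤above x))
      where
      0≤d = p≤q⇒0≤q-p x≤1
      d≤¼ = linear (x ∷ []) (λ { (x ∷ []) → (1ℚ ⊗ (con ¾ ≼ x) ∷ []) , (con 1ℚ :- x ≼ con ¼) }) ≡.refl ¾≤x
    ... | yes one rewrite indicator-yes oneBig? {I} one with 1 ℕ.≤? length (filter (x <?_) I)
    ...   | yes some =
      linear (1ℚ - x ∷ total (truncated (1ℚ - x)) I ∷ total (above x) I ∷ [])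
        (λ { (d ∷ t ∷ a ∷ []) →
          (1ℚ ⊗ (con 0ℚ ≼ t) ∷ 1ℚ ⊗ (con 0ℚ ≼ d :* (a :- con 1ℚ)) ∷ []) ,
          (d :* con 1ℚ :+ con (+ 4 / 1) :* d :* con 0ℚ ≼ t :+ d :* a) }) ≡.refl
        (total-nonNeg (All.map (truncated-nonNeg 0≤d) sizes))
        (0≤* 0≤d (p≤q⇒0≤q-p (subst (_≤ total (above x) I) (ι-def 1) (count-≥ (x <?_) I some))))
      where 0≤d = p≤q⇒0≤q-p x≤1
    ...   | no none =
      linear (1ℚ - x ∷ total (truncated (1ℚ - x)) I ∷ total (above x) I ∷ [])
        (λ { (d ∷ t ∷ a ∷ []) →
          (1ℚ ⊗ (d ≼ t) ∷ 1ℚ ⊗ (con 0ℚ ≼ d :* a) ∷ []) ,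
          (d :* con 1ℚ :+ con (+ 4 / 1) :* d :* con 0ℚ ≼ t :+ d :* a) }) ≡.refl
        (total-truncated 0≤d sizes (oneBig-small ¾≤x one
          (subst (total (above x) I ≤_) ι-0 (count-≤ (x <?_) I (ℕ.≤-pred (ℕ.≰⇒> none))))))
        (0≤* 0≤d (0≤above x))
      where 0≤d = p≤q⇒0≤q-p x≤1

-- Summation over the covered bins of a packing

module _ (p : Packing ℕ) (sizes : All IsSize (map proj₂ p)) where

  private
    bins : List ℕ
    bins = filter (λ β → 1ℚ ≤? load ℕ._≟_ β p) (deduplicate ℕ._≟_ (map proj₁ p))

    bins! : Unique bins
    bins! = Unique.filter⁺ (λ β → 1ℚ ≤? load ℕ._≟_ β p) (deduplicate-! ℕ._≟_ (map proj₁ p))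

    in-bin : ℕ → List ℚ
    in-bin β = contents ℕ._≟_ β p

    in-bin-sizes : ∀ β → All IsSize (in-bin β)
    in-bin-sizes β = All.map⁺ (All.filter⁺ (λ e → proj₁ e ℕ.≟ β) (All.map⁻ sizes))

    full : All (λ β → 1ℚ ≤ total id (in-bin β)) bins
    full = All.map (λ {β} → subst (1ℚ ≤_) (load≡total ℕ._≟_ β p))
      (All.all-filter (λ β → 1ℚ ≤? load ℕ._≟_ β p) (deduplicate ℕ._≟_ (map proj₁ p)))

    ∑ : (List ℚ → ℚ) → ℚ
    ∑ f = total (λ β → f (in-bin β)) bins

    ∑-≤ : ∀ (g : ℚ → ℚ) → (∀ {v} → IsSize v → 0ℚ ≤ g v) → ∑ (total g) ≤ total g (map proj₂ p)
    ∑-≤ g 0≤g = total-contents ℕ._≟_ g p bins! (All.map 0≤g sizes)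

  oneBigBins : ℕ
  oneBigBins = length (filter (λ β → oneBig? (in-bin β)) bins)

  restSmall : ℚ
  restSmall = ∑ smallRest

  private
    oneBigBins≡ : ∑ (indicator oneBig?) ≡ ι oneBigBins
    oneBigBins≡ = ≡.trans (total-cong (λ β → sym (indicator-∘ β)) bins)
        (total-indicator (λ β → oneBig? (in-bin β)) bins)
      where
      indicator-∘ : ∀ β → indicator (λ β → oneBig? (in-bin β)) β ≡ indicator oneBig? (in-bin β)
      indicator-∘ β with oneBig? (in-bin β)
      ... | yes one = ≡.trans (indicator-yes (λ β → oneBig? (in-bin β)) {β} one)
          (sym (indicator-yes oneBig? {in-bin β} one))
      ... | no ¬one = ≡.trans (indicator-no (λ β → oneBig? (in-bin β)) {β} ¬one)
          (sym (indicator-no oneBig? {in-bin β} ¬one))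

  restSmall-nonNeg : 0ℚ ≤ restSmall
  restSmall-nonNeg = total-nonNeg (All.universal (λ β → smallRest-nonNeg (in-bin-sizes β)) bins)

  restSmall-≤ : restSmall ≤ total smallPart (map proj₂ p)
  restSmall-≤ = ≤-trans (total-mono (All.universal (λ β → smallRest-≤ (in-bin-sizes β)) bins))
      (∑-≤ smallPart smallPart-nonNeg)

  oneBigBins-≤ : ι oneBigBins ≤ total (atLeast ¾) (map proj₂ p)
  oneBigBins-≤ = subst (_≤ total (atLeast ¾) (map proj₂ p)) oneBigBins≡
    (≤-trans (total-mono (All.universal (λ β → oneBig-≤ (in-bin-sizes β)) bins))
      (∑-≤ (atLeast ¾) (λ {v} _ → indicator-nonNeg (¾ ≤?_) v)))

  covered-weight : ⅔ * ι (covered ℕ._≟_ p) ≤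
    total weight (map proj₂ p) + + 1 / 6 * ι oneBigBins + ⅔ * restSmall
  covered-weight = begin
    -- `covered ℕ._≟_ p` is `length bins` by definition.
    ⅔ * ι (length bins)
      ≡⟨ total-const ⅔ bins ⟨
    total (λ _ → ⅔) bins
      ≤⟨ total-mono (All.map (λ {β} → weight-bin (in-bin-sizes β)) full) ⟩
    ∑ (λ I → total weight I + + 1 / 6 * indicator oneBig? I + ⅔ * smallRest I)
      ≡⟨ total-+ (λ β → total weight (in-bin β) + + 1 / 6 * indicator oneBig? (in-bin β))
           (λ β → ⅔ * smallRest (in-bin β)) bins ⟩
    ∑ (λ I → total weight I + + 1 / 6 * indicator oneBig? I) + ∑ (λ I → ⅔ * smallRest I)
      ≡⟨ cong₂ _+_
           (total-+ (λ β → total weight (in-bin β)) (λ β → + 1 / 6 * indicator oneBig? (in-bin β)) bins)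
           (total-* ⅔ (λ β → smallRest (in-bin β)) bins) ⟩
    ∑ (total weight) + ∑ (λ I → + 1 / 6 * indicator oneBig? I) + ⅔ * restSmall
      ≡⟨ cong (λ q → ∑ (total weight) + q + ⅔ * restSmall)
          (≡.trans (total-* (+ 1 / 6) (λ β → indicator oneBig? (in-bin β)) bins)
          (cong (+ 1 / 6 *_) oneBigBins≡)) ⟩
    ∑ (total weight) + + 1 / 6 * ι oneBigBins + ⅔ * restSmall
      ≤⟨ +-monoˡ-≤ (⅔ * restSmall) (+-monoˡ-≤ (+ 1 / 6 * ι oneBigBins) (∑-≤ weight weight-nonNeg)) ⟩
    total weight (map proj₂ p) + + 1 / 6 * ι oneBigBins + ⅔ * restSmall ∎
    where open ≤-Reasoning

  truncated-total : ∀ {x} → ¾ ≤ x → x ≤ 1ℚ → let d = 1ℚ - x in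
    d * ι oneBigBins + + 4 / 1 * d * restSmall ≤
      total (truncated d) (map proj₂ p) + d * total (above x) (map proj₂ p)
  truncated-total {x} ¾≤x x≤1 = begin
    d * ι oneBigBins + + 4 / 1 * d * restSmall
      ≡⟨ cong (λ q → d * q + + 4 / 1 * d * restSmall) oneBigBins≡ ⟨
    d * ∑ (indicator oneBig?) + + 4 / 1 * d * restSmall
      ≡⟨ cong₂ _+_ (total-* d (λ β → indicator oneBig? (in-bin β)) bins)
          (total-* (+ 4 / 1 * d) (λ β → smallRest (in-bin β)) bins) ⟨
    ∑ (λ I → d * indicator oneBig? I) + ∑ (λ I → + 4 / 1 * d * smallRest I)
      ≡⟨ total-+ (λ β → d * indicator oneBig? (in-bin β)) (λ β → + 4 / 1 * d * smallRest (in-bin β)) bins ⟨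
    ∑ (λ I → d * indicator oneBig? I + + 4 / 1 * d * smallRest I)
      ≤⟨ total-mono (All.map (λ {β} fullβ → truncated-bin (in-bin-sizes β) fullβ ¾≤x x≤1) full) ⟩
    ∑ (λ I → total (truncated d) I + d * total (above x) I)
      ≡⟨ total-+ (λ β → total (truncated d) (in-bin β)) (λ β → d * total (above x) (in-bin β)) bins ⟩
    ∑ (total (truncated d)) + ∑ (λ I → d * total (above x) I)
      ≡⟨ +-congˡ (∑ (total (truncated d))) (total-* d (λ β → total (above x) (in-bin β)) bins) ⟩
    ∑ (total (truncated d)) + d * ∑ (total (above x))
      ≤⟨ +-mono-≤ (∑-≤ (truncated d) (truncated-nonNeg 0≤d))
           (*-monoˡ-≤-nonNeg d {{nonNegative 0≤d}} (∑-≤ (above x) (λ {v} _ → indicator-nonNeg (x <?_) v))) ⟩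
    total (truncated d) (map proj₂ p) + d * total (above x) (map proj₂ p) ∎
    where
    open ≤-Reasoning
    d = 1ℚ - x
    0≤d = p≤q⇒0≤q-p x≤1

-- The sorted input and its m-th largest item

Antitone : List ℚ → Set
Antitone = AllPairs (λ x y → y ≤ x)

total-above-0 : ∀ {x xs} → All (_≤ x) xs → total (above x) xs ≡ 0ℚ
total-above-0 []          = ≡.refl
total-above-0 {x} (y≤x ∷ h) = ≡.trans (cong₂ _+_ (indicator-no (x <?_) (λ x<y → <⇒≱ x<y y≤x))
    (total-above-0 h)) (+-identityˡ 0ℚ)

total-atLeast-0 : ∀ {a x ys} → ¬ (a ≤ x) → All (_≤ x) ys → total (atLeast a) ys ≡ 0ℚ
total-atLeast-0 a≰x []        = ≡.refl
total-atLeast-0 {a} a≰x (y≤x ∷ p) = ≡.trans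
  (cong₂ _+_ (indicator-no (a ≤?_) (λ a≤y → a≰x (≤-trans a≤y y≤x))) (total-atLeast-0 a≰x p))
      (+-identityˡ 0ℚ)

nth-∈ : ∀ xs {i} → i ℕ.< length xs → nth xs i ∈ xs
nth-∈ (x ∷ xs) {zero}  _   = here ≡.refl
nth-∈ (x ∷ xs) {suc i} i<n = there (nth-∈ xs (s<s⁻¹ i<n))

-- In an antitone list the entries that are at least `a` form a prefix.
nth-≥ : ∀ {xs} a → Antitone xs → ∀ i → ι (suc i) ≤ total (atLeast a) xs → a ≤ nth xs i
nth-≥ a [] i h = contradiction (≤-trans (subst (_≤ ι (suc i)) (ι-def 1) (ι-mono-≤ (s≤s z≤n))) h)
    (<⇒≱ (positive⁻¹ 1ℚ))
nth-≥ {x ∷ xs} a (x≥ ∷ xs↘) i h with a ≤? x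
nth-≥ {x ∷ xs} a (x≥ ∷ xs↘) zero    h | yes a≤x = a≤x
nth-≥ {x ∷ xs} a (x≥ ∷ xs↘) (suc i) h | yes a≤x rewrite indicator-yes (a ≤?_) a≤x =
  nth-≥ a xs↘ i (linear (ι (suc i) ∷ total (atLeast a) xs ∷ [])
    (λ { (n ∷ t ∷ []) → (1ℚ ⊗ (con 1ℚ :+ n ≼ con 1ℚ :+ t) ∷ []) , (n ≼ t) }) ≡.refl
        (subst (_≤ 1ℚ + total (atLeast a) xs) (ι-suc (suc i)) h))
nth-≥ {x ∷ xs} a (x≥ ∷ xs↘) i h | no a≰x rewrite indicator-no (a ≤?_) a≰x | total-atLeast-0 a≰x x≥ =
  contradiction (≤-trans (subst (_≤ ι (suc i)) (ι-def 1) (ι-mono-≤ (s≤s z≤n))) h) (<⇒≱ (positive⁻¹ 1ℚ))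

nth-above : ∀ {xs} → Antitone xs → ∀ i → total (above (nth xs i)) xs ≤ ι (suc i)
nth-above []                     i = 0≤ι (suc i)
nth-above {x ∷ xs} (x≥ ∷ xs↘) zero = subst₂ _≤_
  (≡.trans (sym (+-identityʳ (above x x))) (+-congˡ (above x x) (sym (total-above-0 x≥)))) (sym (ι-def 1))
      (indicator-≤1 (x <?_) x)
nth-above {x ∷ xs} (x≥ ∷ xs↘) (suc i) = subst (total (above (nth xs i)) (x ∷ xs) ≤_) (sym (ι-suc (suc i)))
  (+-mono-≤ (indicator-≤1 (nth xs i <?_) x) (nth-above xs↘ i))

nth-atLeast : ∀ {xs} → Antitone xs → ∀ {i} → i ℕ.< length xs → ι (suc i) ≤ total (atLeast (nth xs i)) xs
nth-atLeast {x ∷ xs} (x≥ ∷ xs↘) {zero}  _ rewrite indicator-yes (x ≤?_) {x} ≤-refl =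
  subst (_≤ 1ℚ + total (atLeast x) xs) (≡.trans (+-identityʳ 1ℚ) (sym (ι-def 1)))
      (+-monoʳ-≤ 1ℚ (total-nonNeg (All.universal (indicator-nonNeg (x ≤?_)) xs)))
nth-atLeast {x ∷ xs} (x≥ ∷ xs↘) {suc i} i< rewrite indicator-yes (nth xs i ≤?_)
    (All.lookup x≥ (nth-∈ xs (s<s⁻¹ i<))) =
  subst (_≤ 1ℚ + total (atLeast (nth xs i)) xs) (sym (ι-suc (suc i)))
      (+-monoʳ-≤ 1ℚ (nth-atLeast xs↘ (s<s⁻¹ i<)))

module _ (σ : List ℚ) where

  private
    sorted = Descending.sort σ
    sorted↭ : sorted ↭ σ
    sorted↭ = Descending.sort-↭ σ
    sorted↘ : Antitone sorted
    sorted↘ = Linked⇒AllPairs (λ j≤i k≤j → ≤-trans k≤j j≤i) (Descending.sort-↗ σ)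

  largest-∈ : ∀ {i} → i ℕ.< length σ → largest σ (suc i) ∈ σ
  largest-∈ i< = ∈-resp-↭ sorted↭ (nth-∈ sorted (subst (_ ℕ.<_) (sym (↭-length sorted↭)) i<))

  -- The hypothesis `a ≤ 1ℚ` serves `m = 0`, where `largest` is the conventional value 1.
  largest-≥ : ∀ {a} m → a ≤ 1ℚ → ι m ≤ total (atLeast a) σ → a ≤ largest σ m
  largest-≥ zero    a≤1 _ = a≤1
  largest-≥ (suc i) _   h = nth-≥ _ sorted↘ i (subst (ι (suc i) ≤_) (total-↭ _ (↭-sym sorted↭)) h)

  largest-above : All IsSize σ → ∀ m → total (above (largest σ m)) σ ≤ ι m
  largest-above sizes zero    = ≤-reflexive
      (≡.trans (total-above-0 (All.map (<⇒≤ ∘ proj₂) sizes)) (sym ι-0))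
  largest-above sizes (suc i) = subst (_≤ ι (suc i)) (total-↭ (above (nth sorted i)) sorted↭)
      (nth-above sorted↘ i)

  largest-atLeast : ∀ {m} → m ℕ.≤ length σ → ι m ≤ total (atLeast (largest σ m)) σ
  largest-atLeast {zero}  _  = subst (_≤ total (atLeast 1ℚ) σ) (sym ι-0)
      (total-nonNeg (All.universal (indicator-nonNeg (1ℚ ≤?_)) σ))
  largest-atLeast {suc i} i< = subst (ι (suc i) ≤_) (total-↭ (atLeast (nth sorted i)) sorted↭)
    (nth-atLeast sorted↘ (subst (i ℕ.<_) (sym (↭-length sorted↭)) i<))

  largest-≤1 : All IsSize σ → ∀ {m} → m ℕ.≤ length σ → largest σ m ≤ 1ℚ
  largest-≤1 sizes {zero}  _  = ≤-refl
  largest-≤1 sizes {suc i} i< = <⇒≤ (proj₂ (All.lookup sizes (largest-∈ i<)))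

numberOf2Items-≤ : ∀ σ → numberOf2Items σ ℕ.≤ length σ
numberOf2Items-≤ = length-filter (2 -item?_)

-- This puts every `m` up to the number of `OneBig` bins into the range that the oracle searches.
big-≤-2Items : ∀ {σ} → All IsSize σ → total (atLeast ¾) σ ≤ ι (numberOf2Items σ)
big-≤-2Items {σ} sizes = subst (total (atLeast ¾) σ ≤_) (total-indicator (2 -item?_) σ)
  (total-mono (All.map big-2Item sizes))
  where
  big-2Item : ∀ {v} → IsSize v → atLeast ¾ v ≤ indicator (2 -item?_) v
  big-2Item {v} (_ , v<1) with ¾ ≤? v
  ... | yes ¾≤v rewrite indicator-yes (2 -item?_) {v} (≤-trans ≤! ¾≤v , v<1) = indicator-≤1 (¾ ≤?_) v
  ... | no  ¾≰v rewrite indicator-no (¾ ≤?_) ¾≰v = indicator-nonNeg (2 -item?_) v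

-- Updating the first element that satisfies a test

does⇒ : ∀ {P : Set} (P? : Dec P) → does P? ≡ true → P
does⇒ (yes p) _ = p

does⇒¬ : ∀ {P : Set} (P? : Dec P) → does P? ≡ false → ¬ P
does⇒¬ (no ¬p) _ = ¬p

if-yes : ∀ {P : Set} (P? : Dec P) {a b : A} → P → (if does P? then a else b) ≡ a
if-yes (yes _) _ = ≡.refl
if-yes (no ¬p) p = contradiction p ¬p

if-no : ∀ {P : Set} (P? : Dec P) {a b : A} → ¬ P → (if does P? then a else b) ≡ b
if-no (yes p) ¬p = contradiction p ¬p
if-no (no _)  _  = ≡.refl

module _ {A : Set} (P : A → Bool) (f : A → A) where

  -- The graph of a successful `updateFirst`. Invariants of the list of critical bins are carried
  -- over by induction on it.
  data UpdatedAt : ℕ → List A → List A → Set where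
    here  : ∀ {x xs} → P x ≡ true → UpdatedAt 0 (x ∷ xs) (f x ∷ xs)
    there : ∀ {x xs i ys} → P x ≡ false → UpdatedAt i xs ys → UpdatedAt (suc i) (x ∷ xs) (x ∷ ys)

  data UpdateView (xs : List A) : Maybe (ℕ × List A) → Set where
    found : ∀ {i ys} → UpdatedAt i xs ys → UpdateView xs (just (i , ys))
    none  : All (λ x → P x ≡ false) xs → UpdateView xs nothing

  updateView : ∀ xs → UpdateView xs (updateFirst P f xs)
  updateView []       = none []
  updateView (x ∷ xs) = cons ≡.refl (updateView xs)
    where
    cons : ∀ {b r} → P x ≡ b → UpdateView xs r →
           UpdateView (x ∷ xs) (if b then just (0 , f x ∷ xs) else Maybe.map (λ (i , ys) →
               suc i , x ∷ ys) r)
    cons {true}  Px (found _) = found (here Px)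
    cons {true}  Px (none _)  = found (here Px)
    cons {false} Px (found u) = found (there Px u)
    cons {false} Px (none h)  = none (Px ∷ h)

  module _ {Q : A → Set} where

    updated-All : ∀ {i xs ys} → UpdatedAt i xs ys → (∀ x → P x ≡ true → Q x → Q (f x)) → All Q xs → All Q ys
    updated-All (here Px)   pres (q ∷ qs) = pres _ Px q ∷ qs
    updated-All (there _ u) pres (q ∷ qs) = q ∷ updated-All u pres qs

    updated-total : ∀ (g : A → ℚ) δ {i xs ys} → UpdatedAt i xs ys →
        (∀ x → P x ≡ true → Q x → δ + g x ≤ g (f x)) →
                    All Q xs → δ + total g xs ≤ total g ys
    updated-total g δ (here {x} {xs} Px) inc (q ∷ qs) =
        subst (_≤ g (f x) + total g xs) (+-assoc δ (g x) (total g xs))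
      (+-monoˡ-≤ (total g xs) (inc x Px q))
    updated-total g δ (there {x} {xs} {ys = ys} _ u) inc (q ∷ qs) =
      linear (δ ∷ g x ∷ total g xs ∷ total g ys ∷ [])
        (λ { (δ ∷ a ∷ b ∷ c ∷ []) → (1ℚ ⊗ (δ :+ b ≼ c) ∷ []) , (δ :+ (a :+ b) ≼ a :+ c) }) ≡.refl
        (updated-total g δ u inc qs)

  updated-total-≡ : ∀ (g : A → ℚ) δ {i xs ys} → UpdatedAt i xs ys → (∀ x → P x ≡ true → g (f x) ≡ δ + g x) →
                    total g ys ≡ δ + total g xs
  updated-total-≡ g δ (here {x} {xs} Px) eq =
      ≡.trans (cong (_+ total g xs) (eq x Px)) (+-assoc δ (g x) (total g xs))
  updated-total-≡ g δ (there {x} {xs} {ys = ys} _ u) eq = ≡.trans (+-congˡ (g x) (updated-total-≡ g δ u eq))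
    (linear-≡ (δ ∷ g x ∷ total g xs ∷ []) (λ { (δ ∷ a ∷ b ∷ []) → a :+ (δ :+ b) , δ :+ (a :+ b) }) ≡.refl)

  updated-length : ∀ {i xs ys} → UpdatedAt i xs ys → length ys ≡ length xs
  updated-length (here _)    = ≡.refl
  updated-length (there _ u) = cong suc (updated-length u)

-- Dual Next Fit

data DNFView (v : ℚ) (i : ℕ) (l : ℚ) : Active → Set where
  closes : 1ℚ ≤ l + v → DNFView v i l (active (suc i) 0ℚ)
  stays  : l + v < 1ℚ → DNFView v i l (active i (l + v))

dnfView : ∀ v i l → DNFView v i l (dualNextFit v (active i l))
dnfView v i l = decide (1ℚ ≤? (l + v))
  where
  decide : (D : Dec (1ℚ ≤ l + v)) → DNFView v i l (if does D then active (suc i) 0ℚ else active i (l + v))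
  decide (yes h) = closes h
  decide (no h)  = stays (≰⇒> h)

loadᴰ : DHBin → Packing DHBin → ℚ
loadᴰ = load _≟ᴮ_

record Stream (p : Packing DHBin) (bin : ℕ → DHBin) (a : Active) : Set where
  open Active a
  field
    closed  : ∀ {i} → i ℕ.< index → 1ℚ ≤ loadᴰ (bin i) p
    current : loadᴰ (bin index) p ≡ level
    unused  : ∀ {i} → index ℕ.< i → loadᴰ (bin i) p ≡ 0ℚ
    level<1 : level < 1ℚ

stream-fresh : ∀ {bin} → Stream [] bin fresh
stream-fresh = record { closed = λ () ; current = ≡.refl ; unused = λ _ → ≡.refl ; level<1 = positive⁻¹ 1ℚ }

stream-other : ∀ {p bin a β v} → (∀ i → β ≢ bin i) → Stream p bin a → Stream ((β , v) ∷ p) bin a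
stream-other {p} {bin} {a} {β} {v} β≢ s = record
  { closed  = λ {i} i< → subst (1ℚ ≤_) (sym (load-there _≟ᴮ_ v p (β≢ i))) (closed i<)
  ; current = ≡.trans (load-there _≟ᴮ_ v p (β≢ _)) current
  ; unused  = λ {i} i> → ≡.trans (load-there _≟ᴮ_ v p (β≢ i)) (unused i>)
  ; level<1 = level<1
  }
  where open Stream s

stream-step : ∀ {p bin a v} → (∀ {i j} → bin i ≡ bin j → i ≡ j) → Stream p bin a →
              Stream ((bin (Active.index a) , v) ∷ p) bin (dualNextFit v a)
stream-step {p} {bin} {active i l} {v} inj s = advance (dnfView v i l)
  where
  open Stream s
  p′ = (bin i , v) ∷ p
  elsewhere : ∀ {j} → i ≢ j → loadᴰ (bin j) p′ ≡ loadᴰ (bin j) p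
  elsewhere i≢j = load-there _≟ᴮ_ v p (i≢j ∘ inj)
  filled : loadᴰ (bin i) p′ ≡ l + v
  filled = ≡.trans (load-here _≟ᴮ_ (bin i) v p) (≡.trans (+-congˡ v current) (+-comm v l))
  advance : ∀ {a′} → DNFView v i l a′ → Stream p′ bin a′
  advance (closes h) = record
    { closed  = λ {j} j<1+i → closed′ (ℕ.m≤n⇒m<n∨m≡n (ℕ.≤-pred j<1+i))
    ; current = ≡.trans (elsewhere (ℕ.<⇒≢ (ℕ.n<1+n i))) (unused (ℕ.n<1+n i))
    ; unused  = λ 1+i<j → ≡.trans (elsewhere (ℕ.<⇒≢ (ℕ.<-trans (ℕ.n<1+n i) 1+i<j)))
        (unused (ℕ.<-trans (ℕ.n<1+n i) 1+i<j))
    ; level<1 = positive⁻¹ 1ℚ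
    }
    where
    closed′ : ∀ {j} → j ℕ.< i ⊎ j ≡ i → 1ℚ ≤ loadᴰ (bin j) p′
    closed′ (inj₁ j<i)    = subst (1ℚ ≤_) (sym (elsewhere (ℕ.<⇒≢ j<i ∘ sym))) (closed j<i)
    closed′ (inj₂ ≡.refl) = subst (1ℚ ≤_) (sym filled) h
  advance (stays h) = record
    { closed  = λ j<i → subst (1ℚ ≤_) (sym (elsewhere (ℕ.<⇒≢ j<i ∘ sym))) (closed j<i)
    ; current = filled
    ; unused  = λ i<j → ≡.trans (elsewhere (ℕ.<⇒≢ i<j)) (unused i<j)
    ; level<1 = h
    }

-- Here `q` counts the items of size at least `1/t` sent to the stream. A closed bin is charged with
-- `t` of them, and `j` stands for those in the active bin, whose level is at least `j / t`. As the
-- level is below 1, always `j < t`.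
Counted : ℕ → Active → ℚ → Set
Counted t a q = ∃[ j ] (q ≤ ι (t ℕ.* index ℕ.+ j) × ι j ≤ ι t * level)
  where open Active a

counted-fresh : ∀ t → Counted t fresh 0ℚ
counted-fresh t = 0 , 0≤ι _ , ≤-reflexive (≡.trans ι-0 (sym (*-zeroʳ (ι t))))

counted-< : ∀ t {j l} → ι j ≤ ι (suc t) * l → l < 1ℚ → j ℕ.< suc t
counted-< t {j} {l} j≤tl l<1 = ι-cancel-< (≤-<-trans j≤tl
  (subst (ι (suc t) * l <_) (*-identityʳ (ι (suc t))) (*-monoʳ-<-pos (ι (suc t)) {{positive 0<ι}} l<1)))
  where
  0<ι : 0ℚ < ι (suc t)
  0<ι = <-≤-trans (positive⁻¹ 1ℚ) (subst (_≤ ι (suc t)) (ι-def 1) (ι-mono-≤ (s≤s z≤n)))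

counted-step : ∀ t {a v q} → 1ℚ ≤ ι (suc t) * v → Active.level a < 1ℚ → Counted (suc t) a q →
               Counted (suc t) (dualNextFit v a) (1ℚ + q)
counted-step t {active i l} {v} {q} 1≤tv l<1 (j , q≤ , j≤tl) = advance (dnfView v i l)
  where
  1+q≤ : 1ℚ + q ≤ ι (suc (suc t ℕ.* i ℕ.+ j))
  1+q≤ = subst (1ℚ + q ≤_) (sym (ι-suc _)) (+-monoʳ-≤ 1ℚ q≤)
  advance : ∀ {a′} → DNFView v i l a′ → Counted (suc t) a′ (1ℚ + q)
  -- The bin just closed takes the new item and the `j ≤ t` items before it, hence at most `suc t`,
  -- and the count for the active bin restarts at 0.
  advance (closes _) = 0 , ≤-trans 1+q≤ (ι-mono-≤ (begin
      suc (suc t ℕ.* i ℕ.+ j)     ≡⟨ ℕ.+-suc (suc t ℕ.* i) j ⟨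
      suc t ℕ.* i ℕ.+ suc j       ≤⟨ ℕ.+-monoʳ-≤ (suc t ℕ.* i) (counted-< t j≤tl l<1) ⟩
      suc t ℕ.* i ℕ.+ suc t       ≡⟨ ℕ.+-comm (suc t ℕ.* i) (suc t) ⟩
      suc t ℕ.+ suc t ℕ.* i       ≡⟨ ℕ.*-suc (suc t) i ⟨
      suc t ℕ.* suc i             ≡⟨ ℕ.+-identityʳ _ ⟨
      suc t ℕ.* suc i ℕ.+ 0       ∎)) , ≤-reflexive (≡.trans ι-0 (sym (*-zeroʳ (ι (suc t)))))
    where open ℕ.≤-Reasoning
  advance (stays _) = suc j , subst (λ n → 1ℚ + q ≤ ι n) (sym (ℕ.+-suc (suc t ℕ.* i) j)) 1+q≤ ,
    linear (ι (suc j) ∷ ι j ∷ ι (suc t) ∷ v ∷ l ∷ []) (λ { (j′ ∷ j ∷ t ∷ v ∷ l ∷ []) →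
      (1ℚ ⊗ (j′ ≼ con 1ℚ :+ j) ∷ 1ℚ ⊗ (j ≼ t :* l) ∷ 1ℚ ⊗ (con 1ℚ ≼ t :* v) ∷ []) , (j′ ≼ t :* (l :+ v)) })
          ≡.refl
      (≤-reflexive (ι-suc j)) j≤tl 1≤tv

-- At most one, two and three items stay behind in the active 2-, 3- and 4-bin; their weights add up
-- to `½ + ⅔ + ¾ = 23/12`.
counted-final : ∀ t {a q} → Active.level a < 1ℚ → Counted (suc t) a q →
    q ≤ ι (suc t) * ι (Active.index a) + ι t
counted-final t {active i l} {q} l<1 (j , q≤ , j≤tl) =
    ≤-trans q≤ (subst (_≤ ι (suc t) * ι i + ι t) (sym (ι-+ (suc t ℕ.* i) j))
  (+-mono-≤ (≤-reflexive (ι-* (suc t) i)) (ι-mono-≤ (ℕ.≤-pred (counted-< t j≤tl l<1)))))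

open Critical
open DHState

-- Critical bins

realLoad : Critical → ℚ
realLoad c = fromMaybe 0ℚ (large c) + smalls c

-- Critical bins are named by position, so the index moves along the list: position `j` of a suffix
-- starting at `i` is the bin `critical (i + j)`.
Loads : Packing DHBin → ℕ → List Critical → Set
Loads p i []       = ⊤
Loads p i (c ∷ cs) = loadᴰ (critical i) p ≡ realLoad c × Loads p (suc i) cs

loads-other : ∀ {p β v} i cs → (∀ j → β ≢ critical j) → Loads p i cs → Loads ((β , v) ∷ p) i cs
loads-other         i []       β≢ _        = tt
loads-other {p} {v = v} i (c ∷ cs) β≢ (eq , h) =
    ≡.trans (load-there _≟ᴮ_ v p (β≢ i)) eq , loads-other (suc i) cs β≢ h

loads-later : ∀ {p v j} i cs → j ℕ.< i → Loads p i cs → Loads ((critical j , v) ∷ p) i cs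
loads-later         i []       j<i _        = tt
loads-later {p} {v} {j} i (c ∷ cs) j<i (eq , h) =
  ≡.trans (load-there _≟ᴮ_ {critical i} {critical j} v p λ { ≡.refl → ℕ.<-irrefl ≡.refl j<i }) eq ,
      loads-later (suc i) cs (ℕ.m<n⇒m<1+n j<i) h

loads-update : ∀ {P f p v j cs cs′} i → UpdatedAt P f j cs cs′ →
    (∀ c → P c ≡ true → realLoad (f c) ≡ v + realLoad c) →
               Loads p i cs → Loads ((critical (i ℕ.+ j) , v) ∷ p) i cs′
loads-update {p = p} {v} i (here {c} {cs} Pc) inc (eq , h) rewrite ℕ.+-identityʳ i =
  ≡.trans (load-here _≟ᴮ_ (critical i) v p) (≡.trans (+-congˡ v eq) (sym (inc c Pc))) , loads-later (suc i)
      cs (ℕ.n<1+n i) h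
loads-update {p = p} {v} i (there {i = j} _ u) inc (eq , h) rewrite ℕ.+-suc i j =
  ≡.trans (load-there _≟ᴮ_ v p λ { e → ℕ.m≢1+m+n i (sym (critical-injective e)) }) eq , loads-update (suc i)
      u inc h
  where
  critical-injective : ∀ {i j} → critical i ≡ critical j → i ≡ j
  critical-injective ≡.refl = ≡.refl

loads-lookup : ∀ {p} i cs → Loads p i cs → All (λ c → 1ℚ ≤ realLoad c) cs →
               ∀ {j} → j ℕ.< length cs → 1ℚ ≤ loadᴰ (critical (i ℕ.+ j)) p
loads-lookup {p} i (c ∷ cs) (eq , h) (1≤ ∷ _)  {zero}  _  =
    subst (λ k → 1ℚ ≤ loadᴰ (critical k) p) (sym (ℕ.+-identityʳ i)) (subst (1ℚ ≤_) (sym eq) 1≤)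
loads-lookup {p} i (c ∷ cs) (_ , h)  (_ ∷ all) {suc j} j< =
    subst (λ k → 1ℚ ≤ loadᴰ (critical k) p) (sym (ℕ.+-suc i j))
    (loads-lookup (suc i) cs h all (ℕ.≤-pred j<))

present : Critical → ℚ
present c = if is-nothing (large c) then 0ℚ else 1ℚ

setLarge : ℚ → Critical → Critical
setLarge v c = record c { large = just v }

addSmall : ℚ → Critical → Critical
addSmall v c = record c { smalls = smalls c + v }

noLarge : Critical → Bool
noLarge c = is-nothing (large c)

unfilled : ℚ → Critical → Bool
unfilled x c = does (virtualLoad x c <? 1ℚ)

-- A refusal keeps its reason: either `v` does not count towards the items of size at least `x_m`,
-- or all critical bins already have their large item, which is what the count is meant to
-- establish.
data LargeView (s : DHState) (v : ℚ) : Maybe (DHBin × DHState) → Set where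
  placed  : ∀ {i cs} → xₘ s ≤ v → UpdatedAt noLarge (setLarge v) i (criticalBins s) cs →
            LargeView s v (just (critical i , record s { criticalBins = cs }))
  refused : v < xₘ s ⊎ All (λ c → noLarge c ≡ false) (criticalBins s) → LargeView s v nothing

largeView : ∀ s v → LargeView s v (placeLarge s v)
largeView s v = decide (xₘ s ≤? v)
  where
  update : ∀ {r} → xₘ s ≤ v → UpdateView noLarge (setLarge v) (criticalBins s) r →
           LargeView s v (Maybe.map (λ (i , cs) → critical i , record s { criticalBins = cs }) r)
  update x≤v (found u) = placed x≤v u
  update x≤v (none h)  = refused (inj₂ h)
  decide : (D : Dec (xₘ s ≤ v)) →
           LargeView s v (if does D then updateCritical noLarge (setLarge v) s else nothing)
  decide (yes x≤v) = update x≤v (updateView noLarge (setLarge v) (criticalBins s))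
  decide (no x≰v)  = refused (inj₁ (≰⇒> x≰v))

data SmallView (s : DHState) (v : ℚ) : DHBin × DHState → Set where
  inCritical : ∀ {i cs} → UpdatedAt (unfilled (xₘ s)) (addSmall v) i (criticalBins s) cs →
               SmallView s v (critical i , record s { criticalBins = cs })
  inSmall    : All (λ c → unfilled (xₘ s) c ≡ false) (criticalBins s) →
               SmallView s v
                 (small (Active.index (smallActive s)) ,
                  record s { smallActive = dualNextFit v (smallActive s) })

smallView : ∀ s v → SmallView s v (placeSmall s v)
smallView s v = update (updateView (unfilled (xₘ s)) (addSmall v) (criticalBins s))
  where
  update : ∀ {r} → UpdateView (unfilled (xₘ s)) (addSmall v) (criticalBins s) r →
           SmallView s v (fromMaybe
                 (small (Active.index (smallActive s)) ,
                  record s { smallActive = dualNextFit v (smallActive s) })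
             (Maybe.map (λ (i , cs) → critical i , record s { criticalBins = cs }) r))
  update (found u) = inCritical u
  update (none h)  = inSmall h

data StepView (s : DHState) (v : ℚ) : Maybe ℕ → DHBin × DHState → Set where
  stepLarge : ∀ {i cs k} → xₘ s ≤ v → UpdatedAt noLarge (setLarge v) i (criticalBins s) cs →
              StepView s v k (critical i , record s { criticalBins = cs })
  stepTyped : ∀ {t} → v < xₘ s ⊎ All (λ c → noLarge c ≡ false) (criticalBins s) →
      StepView s v (just t) (placeTyped s v t)
  stepSmall : ∀ {r} → v < xₘ s ⊎ All (λ c → noLarge c ≡ false) (criticalBins s) → SmallView s v r →
      StepView s v nothing r

stepView : ∀ s v → StepView s v (itemType 4 v) (placeDH 4 s v)
stepView s v = choose (itemType 4 v) (largeView s v) (smallView s v)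
  where
  choose : ∀ k {l r} → LargeView s v l → SmallView s v r →
           StepView s v k (fromMaybe r (l <∣> Maybe.map (placeTyped s v) k))
  choose k        (placed x≤v u) _  = stepLarge x≤v u
  choose (just t) (refused h)    _  = stepTyped h
  choose nothing  (refused h)    sv = stepSmall h sv

-- Before its last small item an unfilled bin holds less than `1 - x` of small items, because its
-- large part counts for at least `x`; the last one adds less than `¼`.
record Good (x : ℚ) (c : Critical) : Set where
  field
    large-≥  : x ≤ fromMaybe x (large c)
    smalls-≥ : 0ℚ ≤ smalls c
    smalls-≤ : smalls c ≤ 1ℚ - x + ¼

Full : ℚ → Critical → Set
Full x c = 1ℚ ≤ virtualLoad x c

-- Bounds the total truncated size of the small items of a critical bin: they
-- stay below 1 - x before the last one, which contributes at most 1 - x.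
fill : ℚ → Critical → ℚ
fill x c = if unfilled x c then smalls c else 1ℚ - x + (1ℚ - x)

fill-unfilled : ∀ x c → virtualLoad x c < 1ℚ → fill x c ≡ smalls c
fill-unfilled x c = if-yes (virtualLoad x c <? 1ℚ)

fill-full : ∀ x c → Full x c → fill x c ≡ 1ℚ - x + (1ℚ - x)
fill-full x c 1≤vl = if-no (virtualLoad x c <? 1ℚ) (λ vl<1 → <⇒≱ vl<1 1≤vl)

smalls-< : ∀ {x c} → Good x c → virtualLoad x c < 1ℚ → smalls c < 1ℚ - x
smalls-< {x} {c} good vl<1 = ≰⇒> λ d≤s → <⇒≱ vl<1
  (linear (x ∷ smalls c ∷ fromMaybe x (large c) ∷ [])
    (λ { (x ∷ s ∷ l ∷ []) → (1ℚ ⊗ (con 1ℚ :- x ≼ s) ∷ 1ℚ ⊗ (x ≼ l) ∷ []) , (con 1ℚ ≼ l :+ s) }) ≡.refl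
    d≤s (Good.large-≥ good))

fill-≤ : ∀ {x c} → Good x c → fill x c ≤ 1ℚ - x + (1ℚ - x)
fill-≤ {x} {c} good with virtualLoad x c <? 1ℚ
... | yes vl<1 = subst (_≤ 1ℚ - x + (1ℚ - x)) (sym (fill-unfilled x c vl<1))
  (linear (1ℚ - x ∷ smalls c ∷ []) (λ { (d ∷ s ∷ []) →
      (+ 2 / 1 ⊗ (s ≼ d) ∷ 1ℚ ⊗ (con 0ℚ ≼ s) ∷ []) , (s ≼ d :+ d) }) ≡.refl
    (<⇒≤ (smalls-< good vl<1)) (Good.smalls-≥ good))
... | no vl≮1 = ≤-reflexive (fill-full x c (≮⇒≥ vl≮1))

-- An unfilled bin has small items of total size strictly below `1 - x`, so it cannot account for
-- twice that amount.
fill-saturated : ∀ {x c} → Good x c → 1ℚ - x + (1ℚ - x) ≤ fill x c → Full x c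
fill-saturated {x} {c} good h = ≮⇒≥ λ vl<1 → <⇒≱ (smalls-< good vl<1)
  (linear (1ℚ - x ∷ smalls c ∷ []) (λ { (d ∷ s ∷ []) →
      (½ ⊗ (d :+ d ≼ s) ∷ ½ ⊗ (con 0ℚ ≼ s) ∷ []) , (d ≼ s) }) ≡.refl
    (subst (1ℚ - x + (1ℚ - x) ≤_) (fill-unfilled x c vl<1) h) (Good.smalls-≥ good))

module _ {x v : ℚ} (x≤v : x ≤ v) where

  setLarge-good : ∀ c → noLarge c ≡ true → Good x c → Good x (setLarge v c)
  setLarge-good c _ good = record { large-≥ = x≤v ; smalls-≥ = smalls-≥ ; smalls-≤ = smalls-≤ }
    where open Good good

  setLarge-virtualLoad : ∀ c → noLarge c ≡ true → virtualLoad x c ≤ virtualLoad x (setLarge v c)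
  setLarge-virtualLoad record { large = nothing ; smalls = s } _ = +-monoˡ-≤ s x≤v

  setLarge-full : ∀ c → noLarge c ≡ true → Full x c → Full x (setLarge v c)
  setLarge-full c nl full = ≤-trans full (setLarge-virtualLoad c nl)

  setLarge-fill : ∀ c → noLarge c ≡ true → Good x c → 0ℚ + fill x c ≤ fill x (setLarge v c)
  setLarge-fill c nl good = subst (_≤ fill x (setLarge v c)) (sym (+-identityˡ (fill x c)))
      (decide (virtualLoad x (setLarge v c) <? 1ℚ))
    where
    decide : Dec (virtualLoad x (setLarge v c) < 1ℚ) → fill x c ≤ fill x (setLarge v c)
    decide (yes vl<1) = ≤-reflexive (≡.trans
        (fill-unfilled x c (≤-<-trans (setLarge-virtualLoad c nl) vl<1))
      (sym (fill-unfilled x (setLarge v c) vl<1)))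
    -- The large item may exceed `x` by enough to fill the bin at once; `fill` then jumps to its
    -- maximum.
    decide (no vl≮1)  = subst (fill x c ≤_) (sym (fill-full x (setLarge v c) (≮⇒≥ vl≮1))) (fill-≤ good)

  setLarge-present : ∀ c → noLarge c ≡ true → present (setLarge v c) ≡ 1ℚ + present c
  setLarge-present record { large = nothing } _ = ≡.refl

  setLarge-realLoad : ∀ c → noLarge c ≡ true → realLoad (setLarge v c) ≡ v + realLoad c
  setLarge-realLoad record { large = nothing ; smalls = s } _ = +-congˡ v (sym (+-identityˡ s))

module _ {x v : ℚ} (0<v : 0ℚ < v) (v<¼ : v < ¼) where

  addSmall-good : ∀ c → unfilled x c ≡ true → Good x c → Good x (addSmall v c)
  addSmall-good c u good = record
    { large-≥  = large-≥
    ; smalls-≥ = 0≤+ smalls-≥ (<⇒≤ 0<v)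
    ; smalls-≤ = +-mono-≤ (<⇒≤ (smalls-< good (does⇒ (virtualLoad x c <? 1ℚ) u))) (<⇒≤ v<¼)
    }
    where open Good good

  addSmall-full : ∀ c → unfilled x c ≡ true → Full x c → Full x (addSmall v c)
  addSmall-full c u full = contradiction full (<⇒≱ (does⇒ (virtualLoad x c <? 1ℚ) u))

  addSmall-fill : ∀ c → unfilled x c ≡ true → Good x c → (1ℚ - x) ⊓ v + fill x c ≤ fill x (addSmall v c)
  addSmall-fill c u good = subst (λ f → (1ℚ - x) ⊓ v + f ≤ fill x (addSmall v c))
      (sym (fill-unfilled x c vl<1))
      (decide (virtualLoad x (addSmall v c) <? 1ℚ))
    where
    vl<1 : virtualLoad x c < 1ℚ
    vl<1 = does⇒ (virtualLoad x c <? 1ℚ) u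
    decide : Dec (virtualLoad x (addSmall v c) < 1ℚ) → (1ℚ - x) ⊓ v + smalls c ≤ fill x (addSmall v c)
    decide (yes vl′<1) = subst ((1ℚ - x) ⊓ v + smalls c ≤_)
        (≡.trans (+-comm v (smalls c)) (sym (fill-unfilled x (addSmall v c) vl′<1)))
      (+-monoˡ-≤ (smalls c) (p⊓q≤q (1ℚ - x) v))
    decide (no vl′≮1)  = subst ((1ℚ - x) ⊓ v + smalls c ≤_) (sym (fill-full x (addSmall v c) (≮⇒≥ vl′≮1)))
      (+-mono-≤ (p⊓q≤p (1ℚ - x) v) (<⇒≤ (smalls-< good vl<1)))

  addSmall-realLoad : ∀ c → unfilled x c ≡ true → realLoad (addSmall v c) ≡ v + realLoad c
  addSmall-realLoad c _ = linear-≡ (fromMaybe 0ℚ (large c) ∷ smalls c ∷ v ∷ [])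
    (λ { (l ∷ s ∷ v ∷ []) → l :+ (s :+ v) , v :+ (l :+ s) }) ≡.refl

-- The invariant of the strategy and its preservation

record Invariant (m : ℕ) (τ : List ℚ) (p : Packing DHBin) (s : DHState) : Set where
  field
    ¾≤x         : ¾ ≤ xₘ s
    x≤1         : xₘ s ≤ 1ℚ
    size        : length (criticalBins s) ≡ m
    good        : All (Good (xₘ s)) (criticalBins s)
    loads       : Loads p 0 (criticalBins s)
    streams     : ∀ t → Stream p (typed t) (typedActive s t)
    smallStream : Stream p small (smallActive s)
    -- `larges` and `fills` are alternatives because the accounting stops once the critical bins are
    -- saturated: later items go elsewhere, but the right-hand side then already states the goal and
    -- persists.
    larges      : total (atLeast (xₘ s)) τ ≤ total present (criticalBins s)
                  ⊎ All (λ c → noLarge c ≡ false) (criticalBins s)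
    fills       : total (truncated (1ℚ - xₘ s)) τ ≤ total (fill (xₘ s)) (criticalBins s)
                  ⊎ All (Full (xₘ s)) (criticalBins s)
    -- The 2-items split into those in critical bins and `q` others, which went to the 2-stream.
    count₂      : ∃[ q ] (total (isType 2) τ ≡ total present (criticalBins s) + q
                          × Counted 2 (typedActive s 2) q)
    count₃      : Counted 3 (typedActive s 3) (total (isType 3) τ)
    count₄      : Counted 4 (typedActive s 4) (total (isType 4) τ)
    -- A small bin closes with load below `5/4`: its level was below 1 and the last item below `¼`.
    smallSum    : total smallPart τ ≤ total smalls (criticalBins s)
                    + + 5 / 4 * ι (Active.index (smallActive s)) + Active.level (smallActive s)

total-skip : ∀ (g : A → ℚ) v τ → g v ≡ 0ℚ → total g (v ∷ τ) ≡ total g τ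
total-skip g v τ gv≡0 = ≡.trans (cong (_+ total g τ) gv≡0) (+-identityˡ (total g τ))

total-prepend : ∀ (g : A → ℚ) v {q} τ → g v ≡ q → total g (v ∷ τ) ≡ q + total g τ
total-prepend g v τ eq = cong (_+ total g τ) eq

module _ {m : ℕ} {τ : List ℚ} {p : Packing DHBin} {s : DHState} {v : ℚ} (inv : Invariant m τ p s) where
  open Invariant inv

  private
    x = xₘ s
    d = 1ℚ - x
    cs = criticalBins s

  larges-refused : v < x ⊎ All (λ c → noLarge c ≡ false) cs →
    total (atLeast x) (v ∷ τ) ≤ total present cs ⊎ All (λ c → noLarge c ≡ false) cs
  larges-refused (inj₂ all) = inj₂ all
  larges-refused (inj₁ v<x) with larges
  ... | inj₂ all = inj₂ all
  ... | inj₁ h   = inj₁ (subst (_≤ total present cs)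
      (sym (total-skip (atLeast x) v τ (indicator-no (x ≤?_) (<⇒≱ v<x)))) h)

  invariant-large : ∀ {i cs′} → itemType 4 v ≡ just 2 → x ≤ v → UpdatedAt noLarge (setLarge v) i cs cs′ →
                    Invariant m (v ∷ τ) ((critical i , v) ∷ p) (record s { criticalBins = cs′ })
  invariant-large {i} {cs′} it x≤v u = record
    { ¾≤x         = ¾≤x
    ; x≤1         = x≤1
    ; size        = ≡.trans (updated-length _ _ u) size
    ; good        = updated-All _ _ u (setLarge-good x≤v) good
    ; loads       = loads-update 0 u (setLarge-realLoad x≤v) loads
    ; streams     = λ t → stream-other (λ _ ()) (streams t)
    ; smallStream = stream-other (λ _ ()) smallStream
    ; larges      = Sum.map larges′ (updated-All _ _ u (λ _ _ _ → ≡.refl)) larges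
    ; fills       = Sum.map fills′ (updated-All _ _ u (setLarge-full x≤v)) fills
    ; count₂      = proj₁ count₂ , count₂′ , proj₂ (proj₂ count₂)
    ; count₃      = subst (Counted 3 (typedActive s 3))
        (sym (total-skip (isType 3) v τ (cong (countOf 3) it))) count₃
    ; count₄      = subst (Counted 4 (typedActive s 4))
        (sym (total-skip (isType 4) v τ (cong (countOf 4) it))) count₄
    ; smallSum    = subst₂
        (λ a b → a ≤ b + + 5 / 4 * ι (Active.index (smallActive s)) + Active.level (smallActive s))
        (sym (total-skip smallPart v τ (cong (λ k → ifSmall k v) it)))
        (sym (≡.trans (updated-total-≡ _ _ smalls 0ℚ u (λ c _ → sym (+-identityˡ (smalls c))))
            (+-identityˡ (total smalls cs)))) smallSum
    }
    where
    present′ : total present cs′ ≡ 1ℚ + total present cs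
    present′ = updated-total-≡ _ _ present 1ℚ u (setLarge-present x≤v)
    larges′ : total (atLeast x) τ ≤ total present cs → total (atLeast x) (v ∷ τ) ≤ total present cs′
    larges′ h = subst₂ _≤_ (sym (total-prepend (atLeast x) v τ (indicator-yes (x ≤?_) x≤v))) (sym present′)
        (+-monoʳ-≤ 1ℚ h)
    fills′ : total (truncated d) τ ≤ total (fill x) cs → total (truncated d) (v ∷ τ) ≤ total (fill x) cs′
    fills′ h = ≤-trans (subst (_≤ 0ℚ + total (fill x) cs)
        (sym (total-prepend (truncated d) v τ (cong (λ k → ifSmall k (d ⊓ v)) it))) (+-monoʳ-≤ 0ℚ h))
      (updated-total _ _ (fill x) 0ℚ u (setLarge-fill x≤v) good)
    count₂′ : total (isType 2) (v ∷ τ) ≡ total present cs′ + proj₁ count₂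
    count₂′ = ≡.trans (total-prepend (isType 2) v τ (cong (countOf 2) it))
        (≡.trans (+-congˡ 1ℚ (proj₁ (proj₂ count₂)))
      (≡.trans (sym (+-assoc 1ℚ (total present cs) (proj₁ count₂)))
          (cong (_+ proj₁ count₂) (sym present′))))

  invariant-typed : ∀ t → itemType 4 v ≡ just t → v < x ⊎ All (λ c → noLarge c ≡ false) cs →
    let s′ = proj₂ (placeTyped s v t) in
    ∃[ q ] (total (isType 2) (v ∷ τ) ≡ total present cs + q × Counted 2 (typedActive s′ 2) q) →
    Counted 3 (typedActive s′ 3) (total (isType 3) (v ∷ τ)) →
    Counted 4 (typedActive s′ 4) (total (isType 4) (v ∷ τ)) →
    Invariant m (v ∷ τ) ((proj₁ (placeTyped s v t) , v) ∷ p) s′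
  invariant-typed t it refusal c₂ c₃ c₄ = record
    { ¾≤x         = ¾≤x
    ; x≤1         = x≤1
    ; size        = size
    ; good        = good
    ; loads       = loads-other 0 cs (λ _ ()) loads
    ; streams     = λ u → stream′ u (u ℕ.≟ t)
    ; smallStream = stream-other (λ _ ()) smallStream
    ; larges      = larges-refused refusal
    ; fills       = Sum.map₁ (subst (_≤ total (fill x) cs)
        (sym (total-skip (truncated d) v τ (cong (λ k → ifSmall k (d ⊓ v)) it)))) fills
    ; count₂      = c₂
    ; count₃      = c₃
    ; count₄      = c₄
    ; smallSum    = subst
        (_≤ total smalls cs + + 5 / 4 * ι (Active.index (smallActive s)) + Active.level (smallActive s))
        (sym (total-skip smallPart v τ (cong (λ k → ifSmall k v) it))) smallSum
    }
    where
    stream′ : ∀ u (D : Dec (u ≡ t)) → Stream ((typed t (Active.index (typedActive s t)) , v) ∷ p) (typed u)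
                (if does D then dualNextFit v (typedActive s u) else typedActive s u)
    stream′ u (yes ≡.refl) = stream-step (λ { ≡.refl → ≡.refl }) (streams u)
    stream′ u (no u≢t)     = stream-other (λ { _ ≡.refl → u≢t ≡.refl }) (streams u)

  skip₂ : isType 2 v ≡ 0ℚ →
    ∃[ q ] (total (isType 2) (v ∷ τ) ≡ total present cs + q × Counted 2 (typedActive s 2) q)
  skip₂ eq =
    proj₁ count₂ , ≡.trans (total-skip (isType 2) v τ eq) (proj₁ (proj₂ count₂)) , proj₂ (proj₂ count₂)

  skip₃ : isType 3 v ≡ 0ℚ → Counted 3 (typedActive s 3) (total (isType 3) (v ∷ τ))
  skip₃ eq = subst (Counted 3 (typedActive s 3)) (sym (total-skip (isType 3) v τ eq)) count₃

  skip₄ : isType 4 v ≡ 0ℚ → Counted 4 (typedActive s 4) (total (isType 4) (v ∷ τ))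
  skip₄ eq = subst (Counted 4 (typedActive s 4)) (sym (total-skip (isType 4) v τ eq)) count₄

  invariant-two : itemType 4 v ≡ just 2 → ½ ≤ v → v < x ⊎ All (λ c → noLarge c ≡ false) cs →
    Invariant m (v ∷ τ) ((proj₁ (placeTyped s v 2) , v) ∷ p) (proj₂ (placeTyped s v 2))
  invariant-two it ½≤v refusal = invariant-typed 2 it refusal
    (1ℚ + proj₁ count₂ ,
     ≡.trans (total-prepend (isType 2) v τ (cong (countOf 2) it))
         (≡.trans (+-congˡ 1ℚ (proj₁ (proj₂ count₂)))
       (linear-≡ (total present cs ∷ proj₁ count₂ ∷ [])
           (λ { (n ∷ q ∷ []) → con 1ℚ :+ (n :+ q) , n :+ (con 1ℚ :+ q) }) ≡.refl)) ,
     counted-step 1 (subst (λ t → 1ℚ ≤ t * v) (sym (ι-def 2))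
       (linear (v ∷ []) (λ { (v ∷ []) → (+ 2 / 1 ⊗ (con ½ ≼ v) ∷ []) , (con 1ℚ ≼ con (+ 2 / 1) :* v) })
           ≡.refl ½≤v))
       (Stream.level<1 (streams 2)) (proj₂ (proj₂ count₂)))
    (skip₃ (cong (countOf 3) it)) (skip₄ (cong (countOf 4) it))

  invariant-three : itemType 4 v ≡ just 3 → ⅓ ≤ v → v < x ⊎ All (λ c → noLarge c ≡ false) cs →
    Invariant m (v ∷ τ) ((proj₁ (placeTyped s v 3) , v) ∷ p) (proj₂ (placeTyped s v 3))
  invariant-three it ⅓≤v refusal = invariant-typed 3 it refusal (skip₂ (cong (countOf 2) it))
    (subst (Counted 3 (dualNextFit v (typedActive s 3)))
        (sym (total-prepend (isType 3) v τ (cong (countOf 3) it)))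
      (counted-step 2 (subst (λ t → 1ℚ ≤ t * v) (sym (ι-def 3))
        (linear (v ∷ []) (λ { (v ∷ []) → (+ 3 / 1 ⊗ (con ⅓ ≼ v) ∷ []) , (con 1ℚ ≼ con (+ 3 / 1) :* v) })
            ≡.refl ⅓≤v))
        (Stream.level<1 (streams 3)) count₃))
    (skip₄ (cong (countOf 4) it))

  invariant-four : itemType 4 v ≡ just 4 → ¼ ≤ v → v < x ⊎ All (λ c → noLarge c ≡ false) cs →
    Invariant m (v ∷ τ) ((proj₁ (placeTyped s v 4) , v) ∷ p) (proj₂ (placeTyped s v 4))
  invariant-four it ¼≤v refusal = invariant-typed 4 it refusal (skip₂ (cong (countOf 2) it))
      (skip₃ (cong (countOf 3) it))
    (subst (Counted 4 (dualNextFit v (typedActive s 4)))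
        (sym (total-prepend (isType 4) v τ (cong (countOf 4) it)))
      (counted-step 3 (subst (λ t → 1ℚ ≤ t * v) (sym (ι-def 4))
        (linear (v ∷ []) (λ { (v ∷ []) → (+ 4 / 1 ⊗ (con ¼ ≼ v) ∷ []) , (con 1ℚ ≼ con (+ 4 / 1) :* v) })
            ≡.refl ¼≤v))
        (Stream.level<1 (streams 4)) count₄))

  invariant-small : itemType 4 v ≡ nothing → 0ℚ < v → v < ¼ → v < x ⊎ All (λ c → noLarge c ≡ false) cs →
    ∀ {r} → SmallView s v r → Invariant m (v ∷ τ) ((proj₁ r , v) ∷ p) (proj₂ r)
  invariant-small it 0<v v<¼ refusal (inCritical {i} {cs′} u) = record
    { ¾≤x         = ¾≤x
    ; x≤1         = x≤1
    ; size        = ≡.trans (updated-length _ _ u) size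
    ; good        = updated-All _ _ u (addSmall-good 0<v v<¼) good
    ; loads       = loads-update 0 u (addSmall-realLoad 0<v v<¼) loads
    ; streams     = λ t → stream-other (λ _ ()) (streams t)
    ; smallStream = stream-other (λ _ ()) smallStream
    ; larges      = Sum.map (λ h → subst (total (atLeast x) (v ∷ τ) ≤_) (sym present′) h)
        (updated-All _ _ u (λ _ _ nl → nl)) (larges-refused refusal)
    ; fills       = Sum.map fills′ (updated-All _ _ u (addSmall-full 0<v v<¼)) fills
    ; count₂      = proj₁ count₂ , ≡.trans (proj₁ (proj₂ (skip₂ (cong (countOf 2) it))))
        (cong (_+ proj₁ count₂) (sym present′)) , proj₂ (proj₂ count₂)
    ; count₃      = skip₃ (cong (countOf 3) it)
    ; count₄      = skip₄ (cong (countOf 4) it)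
    ; smallSum    = subst₂
        (λ a b → a ≤ b + + 5 / 4 * ι (Active.index (smallActive s)) + Active.level (smallActive s))
        (sym (total-prepend smallPart v τ (cong (λ k → ifSmall k v) it)))
        (sym (updated-total-≡ _ _ smalls v u (λ c _ → +-comm (smalls c) v)))
        (linear (v ∷ total smallPart τ ∷ total smalls cs ∷ + 5 / 4 * ι (Active.index (smallActive s)) ∷
            Active.level (smallActive s) ∷ [])
          (λ { (v ∷ t ∷ c ∷ i ∷ l ∷ []) → (1ℚ ⊗ (t ≼ c :+ i :+ l) ∷ []) , (v :+ t ≼ v :+ c :+ i :+ l) })
              ≡.refl smallSum)
    }
    where
    present′ : total present cs′ ≡ total present cs
    present′ = ≡.trans (updated-total-≡ _ _ present 0ℚ u (λ c _ → sym (+-identityˡ (present c))))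
        (+-identityˡ (total present cs))
    fills′ : total (truncated d) τ ≤ total (fill x) cs → total (truncated d) (v ∷ τ) ≤ total (fill x) cs′
    fills′ h = ≤-trans (subst (_≤ d ⊓ v + total (fill x) cs)
        (sym (total-prepend (truncated d) v τ (cong (λ k → ifSmall k (d ⊓ v)) it))) (+-monoʳ-≤ (d ⊓ v) h))
      (updated-total _ _ (fill x) (d ⊓ v) u (addSmall-fill 0<v v<¼) good)
  invariant-small it 0<v v<¼ refusal (inSmall allFull) = record
    { ¾≤x         = ¾≤x
    ; x≤1         = x≤1
    ; size        = size
    ; good        = good
    ; loads       = loads-other 0 cs (λ _ ()) loads
    ; streams     = λ t → stream-other (λ _ ()) (streams t)
    ; smallStream = stream-step (λ { ≡.refl → ≡.refl }) smallStream
    ; larges      = larges-refused refusal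
    -- An item reaches the small stream only when every critical bin is full, so from here on the
    -- second alternative holds.
    ; fills       = inj₂ (All.map (λ {c} u → ≮⇒≥ (does⇒¬ (virtualLoad x c <? 1ℚ) u)) allFull)
    ; count₂      = skip₂ (cong (countOf 2) it)
    ; count₃      = skip₃ (cong (countOf 3) it)
    ; count₄      = skip₄ (cong (countOf 4) it)
    ; smallSum    = subst (_≤ total smalls cs + + 5 / 4 * ι (Active.index a′) + Active.level a′)
        (sym (total-prepend smallPart v τ (cong (λ k → ifSmall k v) it)))
        (advance (dnfView v (Active.index (smallActive s)) (Active.level (smallActive s))))
    }
    where
    a′ = dualNextFit v (smallActive s)
    advance : ∀ {a′} → DNFView v (Active.index (smallActive s)) (Active.level (smallActive s)) a′ →
      v + total smallPart τ ≤ total smalls cs + + 5 / 4 * ι (Active.index a′) + Active.level a′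
    advance (closes _) = linear (v ∷ total smallPart τ ∷ total smalls cs ∷
        ι (Active.index (smallActive s)) ∷ ι (suc (Active.index (smallActive s))) ∷
        Active.level (smallActive s) ∷ [])
      (λ { (v ∷ t ∷ c ∷ i ∷ i′ ∷ l ∷ []) →
        (1ℚ ⊗ (t ≼ c :+ con (+ 5 / 4) :* i :+ l) ∷ + 5 / 4 ⊗ (con 1ℚ :+ i ≼ i′) ∷ 1ℚ ⊗ (l ≼ con 1ℚ) ∷
            1ℚ ⊗ (v ≼ con ¼) ∷ []) ,
        (v :+ t ≼ c :+ con (+ 5 / 4) :* i′ :+ con 0ℚ) }) ≡.refl
      smallSum (≤-reflexive (sym (ι-suc _))) (<⇒≤ (Stream.level<1 smallStream)) (<⇒≤ v<¼)
    advance (stays _) = linear (v ∷ total smallPart τ ∷ total smalls cs ∷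
        + 5 / 4 * ι (Active.index (smallActive s)) ∷ Active.level (smallActive s) ∷ [])
      (λ { (v ∷ t ∷ c ∷ i ∷ l ∷ []) → (1ℚ ⊗ (t ≼ c :+ i :+ l) ∷ []) , (v :+ t ≼ c :+ i :+ (l :+ v)) })
          ≡.refl smallSum

  invariant-step : IsSize v → Invariant m (v ∷ τ) ((proj₁ (placeDH 4 s v) , v) ∷ p) (proj₂ (placeDH 4 s v))
  invariant-step isSize = go ≡.refl (kind isSize) (stepView s v)
    where
    -- Because `x ≥ ¾`, only 2-items can enter a critical bin as its large item.
    tooSmall : ∀ {q} → v < q → q ≤ ¾ → ¬ (x ≤ v)
    tooSmall v<q q≤¾ x≤v = <⇒≱ v<q (≤-trans q≤¾ (≤-trans ¾≤x x≤v))
    go : ∀ {k r} → itemType 4 v ≡ k → Kind v k → StepView s v k r →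
        Invariant m (v ∷ τ) ((proj₁ r , v) ∷ p) (proj₂ r)
    go it (two _ _)       (stepLarge x≤v u)    = invariant-large it x≤v u
    go it (three _ v<½)   (stepLarge x≤v u)    = contradiction x≤v (tooSmall v<½ ≤!)
    go it (four _ v<⅓)    (stepLarge x≤v u)    = contradiction x≤v (tooSmall v<⅓ ≤!)
    go it (tiny _ v<¼)    (stepLarge x≤v u)    = contradiction x≤v (tooSmall v<¼ ≤!)
    go it (two ½≤v _)     (stepTyped refusal)  = invariant-two it ½≤v refusal
    go it (three ⅓≤v _)   (stepTyped refusal)  = invariant-three it ⅓≤v refusal
    go it (four ¼≤v _)    (stepTyped refusal)  = invariant-four it ¼≤v refusal
    go it (tiny 0<v v<¼)  (stepSmall refusal w) = invariant-small it 0<v v<¼ refusal w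

-- Running the strategy on a whole input

run : DHState → List ℚ → DHState
run s []      = s
run s (v ∷ σ) = run (proj₂ (placeDH 4 s v)) σ

packᴰ : DHState → List ℚ → Packing DHBin
packᴰ = AdviceStrategy.pack (DH 4)

-- The invariant grows its lists at the front, so a run produces them reversed; totals and loads do
-- not depend on the order.
invariant-run : ∀ {m σ τ p s} → All IsSize σ → Invariant m τ p s →
                Invariant m (σ ʳ++ τ) (packᴰ s σ ʳ++ p) (run s σ)
invariant-run []              inv = inv
invariant-run (isSize ∷ rest) inv = invariant-run rest (invariant-step inv isSize)

run-xₘ : ∀ s σ → xₘ (run s σ) ≡ xₘ s
run-xₘ s []      = ≡.refl
run-xₘ s (v ∷ σ) = ≡.trans (run-xₘ (proj₂ (placeDH 4 s v)) σ) (step (stepView s v))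
  where
  step : ∀ {k r} → StepView s v k r → xₘ (proj₂ r) ≡ xₘ s
  step (stepLarge _ _)              = ≡.refl
  step (stepTyped _)                = ≡.refl
  step (stepSmall _ (inCritical _)) = ≡.refl
  step (stepSmall _ (inSmall _))    = ≡.refl

emptyCritical : Critical
emptyCritical = record { large = nothing ; smalls = 0ℚ }

total-replicate-0 : ∀ {A : Set} (g : A → ℚ) a → g a ≡ 0ℚ → ∀ m → total g (replicate m a) ≡ 0ℚ
total-replicate-0 g a eq zero    = ≡.refl
total-replicate-0 g a eq (suc m) = ≡.trans (cong₂ _+_ eq (total-replicate-0 g a eq m)) (+-identityˡ 0ℚ)

invariant-initial : ∀ m {x} → ¾ ≤ x → x ≤ 1ℚ → Invariant m [] [] (initial m x)
invariant-initial m {x} ¾≤x x≤1 = record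
  { ¾≤x         = ¾≤x
  ; x≤1         = x≤1
  ; size        = length-replicate m
  ; good        = All.replicate⁺ m record
      { large-≥ = ≤-refl ; smalls-≥ = ≤-refl ; smalls-≤ = 0≤+ (p≤q⇒0≤q-p x≤1) ≤! }
  ; loads       = unloaded 0 m
  ; streams     = λ _ → stream-fresh
  ; smallStream = stream-fresh
  ; larges      = inj₁ (≤-reflexive (sym present≡0))
  ; fills       = inj₁ (total-nonNeg (All.replicate⁺ m fill≥0))
  ; count₂      = 0ℚ , sym (≡.trans (+-identityʳ _) present≡0) , counted-fresh 2
  ; count₃      = counted-fresh 3
  ; count₄      = counted-fresh 4
  ; smallSum    = ≤-reflexive (sym (cong₂ (λ a b →
      a + + 5 / 4 * b + 0ℚ) (total-replicate-0 smalls emptyCritical ≡.refl m) ι-0))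
  }
  where
  present≡0 : total present (replicate m emptyCritical) ≡ 0ℚ
  present≡0 = total-replicate-0 present emptyCritical ≡.refl m
  unloaded : ∀ i m → Loads [] i (replicate m emptyCritical)
  unloaded i zero    = tt
  unloaded i (suc m) = ≡.refl , unloaded (suc i) m
  fill≥0 : 0ℚ ≤ fill x emptyCritical
  fill≥0 with unfilled x emptyCritical
  ... | true  = ≤-refl
  ... | false = 0≤+ (p≤q⇒0≤q-p x≤1) (p≤q⇒0≤q-p x≤1)

-- Covered bins at the end of a run

block : (ℕ → DHBin) → ℕ → List DHBin
block bin n = map bin (upTo n)

block-disjoint : ∀ {bin bin′ n n′} → (∀ i j → bin i ≢ bin′ j) → Disjoint (block bin n) (block bin′ n′)
block-disjoint {bin} {bin′} ≢ (∈b , ∈b′) with ∈-map⁻ bin ∈b | ∈-map⁻ bin′ ∈b′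
... | i , _ , ≡.refl | j , _ , eq = ≢ i j eq

block-unique : ∀ {bin} n → (∀ {i j} → bin i ≡ bin j → i ≡ j) → Unique (block bin n)
block-unique n inj = Unique.map⁺ inj (Unique.upTo⁺ n)

block-all : ∀ {P : DHBin → Set} {bin n} → (∀ {i} → i ℕ.< n → P (bin i)) → All P (block bin n)
block-all h = All.map⁺ (All.tabulate (h ∘ ∈-upTo⁻))

length-block : ∀ bin n → length (block bin n) ≡ n
length-block bin n = ≡.trans (length-map bin (upTo n)) (length-upTo n)

-- The linear inequalities that the final certificates combine. The additive constants are what can
-- be left in the active bins: 1, 2 and 3 typed items, and small items of total size at most 1.
record Result (m : ℕ) (x : ℚ) (τ : List ℚ) (c : ℕ) : Set where
  field
    i₂ i₃ i₄ iₛ : ℕ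
    bins    : ι m + (ι i₂ + (ι i₃ + (ι i₄ + ι iₛ))) ≤ ι c
    twos    : total (isType 2) τ ≤ ι m + (+ 2 / 1 * ι i₂ + + 1 / 1)
    threes  : total (isType 3) τ ≤ + 3 / 1 * ι i₃ + + 2 / 1
    fours   : total (isType 4) τ ≤ + 4 / 1 * ι i₄ + + 3 / 1
    smalls≤ : total smallPart τ ≤ (1ℚ - x + ¼) * ι m + + 5 / 4 * ι iₛ + 1ℚ

module _ {m : ℕ} {τ : List ℚ} {p : Packing DHBin} {s : DHState} (inv : Invariant m τ p s)
         (enoughLarge : ι m ≤ total (atLeast (xₘ s)) τ)
         (enoughSmall : (1ℚ - xₘ s + (1ℚ - xₘ s)) * ι m ≤ total (truncated (1ℚ - xₘ s)) τ) where
  open Invariant inv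

  private
    x = xₘ s
    cs = criticalBins s

  present≤1 : ∀ c → present c ≤ 1ℚ
  present≤1 c with is-nothing (large c)
  ... | true  = ≤!
  ... | false = ≤-refl

  allLarge : All (λ c → noLarge c ≡ false) cs
  allLarge with larges
  ... | inj₂ all = all
  ... | inj₁ h   = All.map (λ {c} → has {c}) (total-saturated present 1ℚ (All.universal present≤1 cs)
        (subst (_≤ total present cs) (≡.trans (cong ι (sym size)) (sym (*-identityˡ _)))
            (≤-trans enoughLarge h)))
    where
    has : ∀ {c} → 1ℚ ≤ present c → noLarge c ≡ false
    has {c} 1≤ with is-nothing (large c)
    ... | true  = contradiction 1≤ (<⇒≱ (positive⁻¹ 1ℚ))
    ... | false = ≡.refl

  -- If the truncated small items have not already been shown to fill every bin, they are all
  -- accounted for by `fill`, so its total reaches the maximum `2 (1 - x)` per bin and each bin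
  -- attains it.
  allFull : All (Full x) cs
  allFull with fills
  ... | inj₂ all = all
  ... | inj₁ h   = All.zipWith (λ (g , f) → fill-saturated g f) (good ,
        total-saturated (fill x) (1ℚ - x + (1ℚ - x)) (All.map fill-≤ good)
          (subst (λ n → (1ℚ - x + (1ℚ - x)) * ι n ≤ total (fill x) cs) (sym size) (≤-trans enoughSmall h)))

  -- Once the large item is present, the virtual load is the real load.
  allCovered : All (λ c → 1ℚ ≤ realLoad c) cs
  allCovered = All.zipWith (λ { {c} (l , f) → real c l f }) (allLarge , allFull)
    where
    real : ∀ c → noLarge c ≡ false → Full x c → 1ℚ ≤ realLoad c
    real record { large = just _ } _ full = full

  private
    i₂ = Active.index (typedActive s 2)
    i₃ = Active.index (typedActive s 3)
    i₄ = Active.index (typedActive s 4)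
    iₛ = Active.index (smallActive s)
    blocks : List (List DHBin)
    blocks = block critical m ∷ block (typed 2) i₂ ∷ block (typed 3) i₃ ∷ block (typed 4) i₄ ∷ block small
        iₛ ∷ []

  blocks-unique : Unique (concat blocks)
  blocks-unique = Unique.concat⁺
    (block-unique m (λ { ≡.refl → ≡.refl }) ∷ block-unique i₂ (λ { ≡.refl → ≡.refl }) ∷ block-unique i₃
        (λ { ≡.refl → ≡.refl }) ∷
     block-unique i₄ (λ { ≡.refl → ≡.refl }) ∷ block-unique iₛ (λ { ≡.refl → ≡.refl }) ∷ [])
    ((block-disjoint (λ _ _ ()) ∷ block-disjoint (λ _ _ ()) ∷ block-disjoint (λ _ _ ()) ∷ block-disjoint
        (λ _ _ ()) ∷ []) ∷
     (block-disjoint (λ _ _ ()) ∷ block-disjoint (λ _ _ ()) ∷ block-disjoint (λ _ _ ()) ∷ []) ∷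
     (block-disjoint (λ _ _ ()) ∷ block-disjoint (λ _ _ ()) ∷ []) ∷
     (block-disjoint (λ _ _ ()) ∷ []) ∷
     [] ∷ [])

  blocks-covered : All (λ β → 1ℚ ≤ loadᴰ β p) (concat blocks)
  blocks-covered = All.concat⁺
    (block-all (λ i<m → loads-lookup 0 cs loads allCovered (subst (_ ℕ.<_) (sym size) i<m)) ∷
     block-all (Stream.closed (streams 2)) ∷ block-all (Stream.closed (streams 3)) ∷
     block-all (Stream.closed (streams 4)) ∷ block-all (Stream.closed smallStream) ∷ [])

  blocks-length : ι (length (concat blocks)) ≡ ι m + (ι i₂ + (ι i₃ + (ι i₄ + ι iₛ)))
  blocks-length = ≡.trans (next critical m _) (+-congˡ (ι m) (≡.trans (next (typed 2) i₂ _) (+-congˡ (ι i₂)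
      (≡.trans (next (typed 3) i₃ _) (+-congˡ (ι i₃) (≡.trans (next (typed 4) i₄ _) (+-congˡ (ι i₄)
        (≡.trans (next small iₛ []) (≡.trans (+-congˡ (ι iₛ) ι-0) (+-identityʳ (ι iₛ)))))))))))
    where
    next : ∀ bin n L → ι (length (block bin n ++ L)) ≡ ι n + ι (length L)
    next bin n L = ≡.trans (cong ι (length-++ (block bin n)))
        (≡.trans (ι-+ _ (length L)) (cong (λ k → ι k + ι (length L)) (length-block bin n)))

  result : ∀ {c} → length (concat blocks) ℕ.≤ c → Result m x τ c
  result {c} len = record
    { i₂ = i₂ ; i₃ = i₃ ; i₄ = i₄ ; iₛ = iₛ
    ; bins    = subst (_≤ ι c) blocks-length (ι-mono-≤ len)
    ; twos    = subst (_≤ ι m + (+ 2 / 1 * ι i₂ + + 1 / 1)) (sym (proj₁ (proj₂ count₂))) (+-mono-≤ presents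
        (subst₂ (λ a b → proj₁ count₂ ≤ a * ι i₂ + b) (ι-def 2) (ι-def 1)
            (counted-final 1 (Stream.level<1 (streams 2)) (proj₂ (proj₂ count₂)))))
    ; threes  = subst₂ (λ a b → total (isType 3) τ ≤ a * ι i₃ + b) (ι-def 3) (ι-def 2)
        (counted-final 2 (Stream.level<1 (streams 3)) count₃)
    ; fours   = subst₂ (λ a b → total (isType 4) τ ≤ a * ι i₄ + b) (ι-def 4) (ι-def 3)
        (counted-final 3 (Stream.level<1 (streams 4)) count₄)
    ; smalls≤ = ≤-trans smallSum (+-mono-≤ (+-monoˡ-≤ (+ 5 / 4 * ι iₛ) criticalSmalls)
        (<⇒≤ (Stream.level<1 smallStream)))
    }
    where
    presents : total present cs ≤ ι m
    presents = subst (total present cs ≤_)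
        (≡.trans (total-const 1ℚ cs) (≡.trans (*-identityˡ _) (cong ι size)))
      (total-mono (All.universal present≤1 cs))
    criticalSmalls : total smalls cs ≤ (1ℚ - x + ¼) * ι m
    criticalSmalls = subst (total smalls cs ≤_)
        (≡.trans (total-const (1ℚ - x + ¼) cs) (cong (λ n → (1ℚ - x + ¼) * ι n) size))
      (total-mono (All.map Good.smalls-≤ good))

total-reverse : ∀ (g : ℚ → ℚ) σ → total g (σ ʳ++ []) ≡ total g σ
total-reverse g σ = ≡.trans (total-ʳ++ g σ []) (+-identityʳ (total g σ))

DH-result : ∀ m {x σ} → ¾ ≤ x → x ≤ 1ℚ → All IsSize σ → ι m ≤ total (atLeast x) σ →
  (1ℚ - x + (1ℚ - x)) * ι m ≤ total (truncated (1ℚ - x)) σ →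
  Result m x (σ ʳ++ []) (covered _≟ᴮ_ (packᴰ (initial m x) σ))
DH-result m {x} {σ} ¾≤x x≤1 sizes enoughLarge enoughSmall =
  finish (run-xₘ (initial m x) σ) (invariant-run sizes (invariant-initial m ¾≤x x≤1))
  where
  p = packᴰ (initial m x) σ
  -- The final state becomes a variable `s`, so that `xₘ s ≡ x` can be matched with `refl`.
  finish : ∀ {s} → xₘ s ≡ x → Invariant m (σ ʳ++ []) (p ʳ++ []) s → Result m x (σ ʳ++ []) (covered _≟ᴮ_ p)
  finish {s} ≡.refl inv = result inv large′ small′
      (covered-≥ _≟ᴮ_ p (blocks-unique inv large′ small′)
          (All.map (λ {β} → subst (1ℚ ≤_) (unreverse β)) (blocks-covered inv large′ small′)))
    where
    large′ = subst (ι m ≤_) (sym (total-reverse (atLeast x) σ)) enoughLarge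
    small′ = subst ((1ℚ - x + (1ℚ - x)) * ι m ≤_) (sym (total-reverse (truncated (1ℚ - x)) σ)) enoughSmall
    unreverse : ∀ β → loadᴰ β (p ʳ++ []) ≡ loadᴰ β p
    unreverse β = ≡.trans (load-ʳ++ _≟ᴮ_ β p []) (+-identityʳ (loadᴰ β p))

-- The competitive bound

total-weight : ∀ {σ} → All IsSize σ →
  total weight σ ≡ ½ * total (isType 2) σ + ⅓ * total (isType 3) σ + ¼ * total (isType 4) σ
total-weight []                         = ≡.refl
total-weight {v ∷ σ} (isSize ∷ sizes) = ≡.trans (cong₂ _+_ (weight-types isSize) (total-weight sizes))
  (linear-≡ (isType 2 v ∷ isType 3 v ∷ isType 4 v ∷ total (isType 2) σ ∷ total (isType 3) σ ∷ total
      (isType 4) σ ∷ [])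
    (λ { (a ∷ b ∷ c ∷ a′ ∷ b′ ∷ c′ ∷ []) →
      con ½ :* a :+ con ⅓ :* b :+ con ¼ :* c :+ (con ½ :* a′ :+ con ⅓ :* b′ :+ con ¼ :* c′) ,
      con ½ :* (a :+ a′) :+ con ⅓ :* (b :+ b′) :+ con ¼ :* (c :+ c′) }) ≡.refl)

greatest : ∀ {P : ℕ → Set} → (∀ m → Dec (P m)) → P 0 → ∀ n → ∃[ m ] (m ℕ.≤ n × P m × (m ≡ n ⊎ ¬ P (suc m)))
greatest P? P0 zero    = 0 , z≤n , P0 , inj₁ ≡.refl
greatest P? P0 (suc n) with greatest P? P0 n
... | m , m≤n , Pm , inj₂ ¬P = m , ℕ.m≤n⇒m≤1+n m≤n , Pm , inj₂ ¬P
... | m , m≤n , Pm , inj₁ ≡.refl with P? (suc n)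
...   | yes P = suc n , ℕ.≤-refl , P , inj₁ ≡.refl
...   | no ¬P = n , ℕ.n≤1+n n , Pm , inj₂ ¬P

emulate-≤-best : ∀ k σ {m} → m ℕ.≤ numberOf2Items σ → emulate k σ m ℕ.≤ emulate k σ (bestM k σ)
emulate-≤-best k σ m≤ = All.lookup (f[xs]≤f[argmax] {f = emulate k σ} 0 (upTo (suc (numberOf2Items σ))))
    (∈-upTo⁺ (s≤s m≤))

module _ (p : Packing ℕ) (sizes : All IsSize (map proj₂ p)) where

  private
    σ = map proj₂ p
    n = oneBigBins p sizes
    r = restSmall p sizes
    S = total smallPart σ
    bound = λ c → ⅔ * ι (covered ℕ._≟_ p) - + 173 / 60 ≤ c

  module _ {m : ℕ} (m≤n : m ℕ.≤ n) (3m≤ : + 3 / 1 * ι m ≤ ι n + + 4 / 1 * r) where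

    private
      x = largest σ m
      d = 1ℚ - x

    m≤big : ι m ≤ total (atLeast ¾) σ
    m≤big = ≤-trans (ι-mono-≤ m≤n) (oneBigBins-≤ p sizes)

    m≤2Items : m ℕ.≤ numberOf2Items σ
    m≤2Items = ι-cancel-≤ (≤-trans m≤big (big-≤-2Items sizes))

    m≤length : m ℕ.≤ length σ
    m≤length = ℕ.≤-trans m≤2Items (numberOf2Items-≤ σ)

    ¾≤x : ¾ ≤ x
    ¾≤x = largest-≥ σ m ≤! m≤big

    x≤1 : x ≤ 1ℚ
    x≤1 = largest-≤1 σ sizes m≤length

    enoughSmall : (d + d) * ι m ≤ total (truncated d) σ
    enoughSmall = linear (d ∷ ι m ∷ ι n ∷ r ∷ total (truncated d) σ ∷ total (above x) σ ∷ [])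
      (λ { (d ∷ m ∷ n ∷ r ∷ t ∷ a ∷ []) →
        (1ℚ ⊗ (d :* n :+ con (+ 4 / 1) :* d :* r ≼ t :+ d :* a) ∷
         -- This row and the next are hypotheses already multiplied by `d ≥ 0`, since a linear
         -- combination cannot form products: at most `m` items lie above `x`, and `3m ≤ n + 4r`.
         1ℚ ⊗ (con 0ℚ ≼ d :* (m :- a)) ∷
         1ℚ ⊗ (con 0ℚ ≼ d :* (n :+ con (+ 4 / 1) :* r :- con (+ 3 / 1) :* m)) ∷ []) ,
        ((d :+ d) :* m ≼ t) }) ≡.refl
      (truncated-total p sizes ¾≤x x≤1)
      (0≤* (p≤q⇒0≤q-p x≤1) (p≤q⇒0≤q-p (largest-above σ sizes m)))
      (0≤* (p≤q⇒0≤q-p x≤1) (p≤q⇒0≤q-p 3m≤))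

    open Result (DH-result m ¾≤x x≤1 sizes (largest-atLeast σ m≤length) enoughSmall)

    covered-≤ : ⅔ * ι (covered ℕ._≟_ p) ≤
      ½ * total (isType 2) σ + ⅓ * total (isType 3) σ + ¼ * total (isType 4) σ + + 1 / 6 * ι n + ⅔ * r
    covered-≤ = subst (λ w → ⅔ * ι (covered ℕ._≟_ p) ≤ w + + 1 / 6 * ι n + ⅔ * r) (total-weight sizes)
        (covered-weight p sizes)

    bound-at : m ≡ n ⊎ ¬ (+ 3 / 1 * ι (suc m) ≤ ι n + + 4 / 1 * r) → bound (ι (emulate 4 σ m))
    bound-at (inj₂ ¬more) =
      linear (ι (covered ℕ._≟_ p) ∷ ι (emulate 4 σ m) ∷ ι m ∷ ι n ∷ r ∷ ι i₂ ∷ ι i₃ ∷ ι i₄ ∷ ι iₛ ∷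
              total (isType 2) σ ∷ total (isType 3) σ ∷ total (isType 4) σ ∷ ι (suc m) ∷ [])
        (λ { (o ∷ c ∷ m ∷ n ∷ r ∷ i₂ ∷ i₃ ∷ i₄ ∷ iₛ ∷ n₂ ∷ n₃ ∷ n₄ ∷ m′ ∷ []) →
          (1ℚ ⊗ (con ⅔ :* o ≼ con ½ :* n₂ :+ con ⅓ :* n₃ :+ con ¼ :* n₄ :+ con (+ 1 / 6) :* n :+ con
              ⅔ :* r) ∷
           1ℚ ⊗ (m :+ (i₂ :+ (i₃ :+ (i₄ :+ iₛ))) ≼ c) ∷
           ½ ⊗ (n₂ ≼ m :+ (con (+ 2 / 1) :* i₂ :+ con 1ℚ)) ∷
           ⅓ ⊗ (n₃ ≼ con (+ 3 / 1) :* i₃ :+ con (+ 2 / 1)) ∷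
           ¼ ⊗ (n₄ ≼ con (+ 4 / 1) :* i₄ :+ con (+ 3 / 1)) ∷
           + 1 / 6 ⊗ (n :+ con (+ 4 / 1) :* r ≼ con (+ 3 / 1) :* m′) ∷
           ½ ⊗ (m′ ≼ con 1ℚ :+ m) ∷
           1ℚ ⊗ (con 0ℚ ≼ iₛ) ∷
           -- `145/60 = 23/12 + ½`, where `½` is lost by rounding `m` down to an integer.
           1ℚ ⊗ (con (+ 145 / 60) ≼ con (+ 173 / 60)) ∷ []) ,
          (con ⅔ :* o :- con (+ 173 / 60) ≼ c) }) ≡.refl
        covered-≤ bins
        (subst (_≤ ι m + (+ 2 / 1 * ι i₂ + 1ℚ)) (total-reverse (isType 2) σ) twos)
        (subst (_≤ + 3 / 1 * ι i₃ + + 2 / 1) (total-reverse (isType 3) σ) threes)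
        (subst (_≤ + 4 / 1 * ι i₄ + + 3 / 1) (total-reverse (isType 4) σ) fours)
        (<⇒≤ (≰⇒> ¬more)) (≤-reflexive (ι-suc m)) (0≤ι iₛ) ≤!
    bound-at (inj₁ m≡n) =
      linear (ι (covered ℕ._≟_ p) ∷ ι (emulate 4 σ m) ∷ ι m ∷ ι n ∷ r ∷ ι i₂ ∷ ι i₃ ∷ ι i₄ ∷ ι iₛ ∷
              total (isType 2) σ ∷ total (isType 3) σ ∷ total (isType 4) σ ∷ S ∷ x ∷ [])
        (λ { (o ∷ c ∷ m ∷ n ∷ r ∷ i₂ ∷ i₃ ∷ i₄ ∷ iₛ ∷ n₂ ∷ n₃ ∷ n₄ ∷ S ∷ x ∷ []) →
          (1ℚ ⊗ (con ⅔ :* o ≼ con ½ :* n₂ :+ con ⅓ :* n₃ :+ con ¼ :* n₄ :+ con (+ 1 / 6) :* n :+ con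
              ⅔ :* r) ∷
           1ℚ ⊗ (m :+ (i₂ :+ (i₃ :+ (i₄ :+ iₛ))) ≼ c) ∷
           ½ ⊗ (n₂ ≼ m :+ (con (+ 2 / 1) :* i₂ :+ con 1ℚ)) ∷
           ⅓ ⊗ (n₃ ≼ con (+ 3 / 1) :* i₃ :+ con (+ 2 / 1)) ∷
           ¼ ⊗ (n₄ ≼ con (+ 4 / 1) :* i₄ :+ con (+ 3 / 1)) ∷
           -- The factor `4/5` solves the volume bound for `iₛ`. The row with `(x :- con ¾) :* m`
           -- below lowers the use of a critical bin from `1 - x + ¼` to the uniform `½`.
           + 4 / 5 ⊗ (S ≼ (con 1ℚ :- x :+ con ¼) :* m :+ con (+ 5 / 4) :* iₛ :+ con 1ℚ) ∷
           + 4 / 5 ⊗ (r ≼ S) ∷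
           + 4 / 5 ⊗ (con 0ℚ ≼ (x :- con ¾) :* m) ∷
           -- With `m = n` the remaining difference is `2/15 (r - n/2)`, which is `1/30` of the
           -- slack in `3m ≤ n + 4r`.
           + 1 / 30 ⊗ (con (+ 3 / 1) :* m ≼ n :+ con (+ 4 / 1) :* r) ∷
           + 1 / 5 ⊗ (n ≼ m) ∷
           -- `163/60 = 23/12 + 4/5`, where `4/5` pays for the contents of the active small bin.
           1ℚ ⊗ (con (+ 163 / 60) ≼ con (+ 173 / 60)) ∷ []) ,
          (con ⅔ :* o :- con (+ 173 / 60) ≼ c) }) ≡.refl
        covered-≤ bins
        (subst (_≤ ι m + (+ 2 / 1 * ι i₂ + 1ℚ)) (total-reverse (isType 2) σ) twos)
        (subst (_≤ + 3 / 1 * ι i₃ + + 2 / 1) (total-reverse (isType 3) σ) threes)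
        (subst (_≤ + 4 / 1 * ι i₄ + + 3 / 1) (total-reverse (isType 4) σ) fours)
        (subst (_≤ (1ℚ - x + ¼) * ι m + + 5 / 4 * ι iₛ + 1ℚ) (total-reverse smallPart σ) smalls≤)
        (restSmall-≤ p sizes) (0≤* (p≤q⇒0≤q-p ¾≤x) (0≤ι m)) 3m≤ (≤-reflexive (cong ι (sym m≡n))) ≤!

  packing-bound : ∃[ m ] (m ℕ.≤ numberOf2Items σ × bound (ι (emulate 4 σ m)))
  packing-bound = finish (greatest (λ m → + 3 / 1 * ι m ≤? (ι n + + 4 / 1 * r)) 0≤ n)
    where
    0≤ : + 3 / 1 * ι 0 ≤ ι n + + 4 / 1 * r
    0≤ = subst (λ z → + 3 / 1 * z ≤ ι n + + 4 / 1 * r) (sym ι-0)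
        (0≤+ (0≤ι n) (0≤* {+ 4 / 1} ≤! (restSmall-nonNeg p sizes)))
    finish : ∃[ m ] (m ℕ.≤ n × + 3 / 1 * ι m ≤ ι
        n + + 4 / 1 * r × (m ≡ n ⊎ ¬ (+ 3 / 1 * ι (suc m) ≤ ι n + + 4 / 1 * r))) →
             ∃[ m ] (m ℕ.≤ numberOf2Items σ × bound (ι (emulate 4 σ m)))
    finish (m , m≤n , 3m≤ , maximal) = m , m≤2Items m≤n 3m≤ , bound-at m≤n 3m≤ maximal

competitive : ∀ {σ} → All IsSize σ → ⅔ * ι (OPT σ) - + 173 / 60 ≤ ι (emulate 4 σ (bestM 4 σ))
competitive {σ} sizes = finish (OPT-packing σ)
  where
  choose : ∀ {σ o c} → o ℕ.≤ c → ∃[ m ] (m ℕ.≤ numberOf2Items σ × ⅔ * ι c - + 173 / 60 ≤ ι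
      (emulate 4 σ m)) →
           ⅔ * ι o - + 173 / 60 ≤ ι (emulate 4 σ (bestM 4 σ))
  choose {σ} o≤c (m , m≤ , h) = ≤-trans (+-monoˡ-≤ (- (+ 173 / 60)) (*-monoˡ-≤-nonNeg ⅔ (ι-mono-≤ o≤c)))
    (≤-trans h (ι-mono-≤ (emulate-≤-best 4 σ m≤)))
  unpack : ∀ p {σ o} → map proj₂ p ≡ σ → All IsSize σ → o ℕ.≤ covered ℕ._≟_ p →
           ⅔ * ι o - + 173 / 60 ≤ ι (emulate 4 σ (bestM 4 σ))
  unpack p ≡.refl sizes o≤ = choose {map proj₂ p} o≤ (packing-bound p sizes)
  finish : ∃[ p ] (map proj₂ p ≡ σ × OPT σ ℕ.≤ covered ℕ._≟_ p) →
      ⅔ * ι (OPT σ) - + 173 / 60 ≤ ι (emulate 4 σ (bestM 4 σ))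
  finish (p , eq , OPT≤) = unpack p eq sizes OPT≤

-- Decoding the advice

>>=-just : ∀ {A B} (r : Reader A) (f : A → Reader B) tape {a rest} →
           r tape ≡ just (a , rest) → (r >>= f) tape ≡ f a rest
>>=-just r f tape eq = cong (Maybe._>>= λ (a , rest) → f a rest) eq

readUnary-replicate : ∀ l rest → readUnary (replicate l true ++ false ∷ rest) ≡ just (l , rest)
readUnary-replicate zero    rest = ≡.refl
readUnary-replicate (suc l) rest = cong (Maybe.map _) (readUnary-replicate l rest)

readBits-++ : ∀ bs rest → readBits (length bs) (bs ++ rest) ≡ just (bs , rest)
readBits-++ []       rest = ≡.refl
readBits-++ (b ∷ bs) rest = cong (Maybe.map _) (readBits-++ bs rest)

value-increment : ∀ bs → value (increment bs) ≡ suc (value bs)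
value-increment []           = ≡.refl
value-increment (false ∷ bs) = ≡.refl
value-increment (true ∷ bs)  = ≡.trans (cong (2 ℕ.*_) (value-increment bs)) (ℕ.*-suc 2 (value bs))

value-binary : ∀ n → value (binary n) ≡ n
value-binary zero    = ≡.refl
value-binary (suc n) = ≡.trans (value-increment (binary n)) (cong suc (value-binary n))

readSelfDelimiting-++ : ∀ s rest → readSelfDelimiting (selfDelimiting s ++ rest) ≡ just (s , rest)
readSelfDelimiting-++ s rest = begin
  readSelfDelimiting (selfDelimiting s ++ rest)
    ≡⟨ >>=-just readUnary _ (selfDelimiting s ++ rest) {length b} {b ++ s ++ rest}
        (≡.trans (cong readUnary regroup) (readUnary-replicate (length b) (b ++ s ++ rest))) ⟩
  (readBits (length b) >>= λ b → readBits (value b)) (b ++ s ++ rest)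
    ≡⟨ >>=-just (readBits (length b)) (λ b →
        readBits (value b)) (b ++ s ++ rest) (readBits-++ b (s ++ rest)) ⟩
  readBits (value b) (s ++ rest)
    ≡⟨ cong (λ l → readBits l (s ++ rest)) (value-binary (length s)) ⟩
  readBits (length s) (s ++ rest)
    ≡⟨ readBits-++ s rest ⟩
  just (s , rest) ∎
  where
  open ≡.≡-Reasoning
  b = binary (length s)
  regroup : selfDelimiting s ++ rest ≡ replicate (length b) true ++ false ∷ (b ++ s ++ rest)
  regroup = ≡.trans (++-assoc (replicate (length b) true ++ false ∷ []) (b ++ s) rest)
    (≡.trans (++-assoc (replicate (length b) true) (false ∷ []) ((b ++ s) ++ rest))
      (cong (λ t → replicate (length b) true ++ false ∷ t) (++-assoc b s rest)))

readℕ-++ : ∀ n rest → readℕ (encodeℕ n ++ rest) ≡ just (n , rest)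
readℕ-++ n rest = ≡.trans (>>=-just readSelfDelimiting (λ s →
    return (value s)) (encodeℕ n ++ rest) (readSelfDelimiting-++ (binary n) rest))
  (cong (λ k → just (k , rest)) (value-binary n))

readℚ-++ : ∀ q rest → 0ℚ ≤ q → readℚ (encodeℚ q ++ rest) ≡ just (q , rest)
readℚ-++ (mkℚ (+ n) d c) rest 0≤q = ≡.trans
  (>>=-just readℕ _ (encodeℚ q ++ rest) {n} {encodeℕ (suc d) ++ rest}
    (≡.trans (cong readℕ (++-assoc (encodeℕ n) (encodeℕ (suc d)) rest))
        (readℕ-++ n (encodeℕ (suc d) ++ rest))))
  (≡.trans (>>=-just readℕ _ (encodeℕ (suc d) ++ rest) (readℕ-++ (suc d) rest))
      (cong (λ q → just (q , rest)) (↥p/↧p≡p q)))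
  where q = mkℚ (+ n) d c
readℚ-++ (mkℚ -[1+ n ] d c) rest (*≤* ())

-- Length of the advice

length-increment : ∀ bs → length (increment bs) ℕ.≤ suc (length bs)
length-increment []           = ℕ.≤-refl
length-increment (false ∷ bs) = ℕ.n≤1+n _
length-increment (true ∷ bs)  = s≤s (length-increment bs)

length-binary-≤ : ∀ n → length (binary n) ℕ.≤ n
length-binary-≤ zero    = z≤n
length-binary-≤ (suc n) = ℕ.≤-trans (length-increment (binary n)) (s≤s (length-binary-≤ n))

-- With the least significant bit first, doubling prepends a bit. Zero, encoded by `[]`, is the
-- exception, hence the `suc n` in `binary-even`.
binary-odd : ∀ n → binary (suc (n ℕ.+ n)) ≡ true ∷ binary n
binary-odd zero    = ≡.refl
binary-odd (suc n) rewrite ℕ.+-suc n n | binary-odd n = ≡.refl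

binary-even : ∀ n → binary (suc n ℕ.+ suc n) ≡ false ∷ binary (suc n)
binary-even n rewrite ℕ.+-suc n n | binary-odd n = ≡.refl

parity : ∀ n → ∃[ j ] (n ≡ j ℕ.+ j ⊎ n ≡ suc (j ℕ.+ j))
parity zero    = 0 , inj₁ ≡.refl
parity (suc n) with parity n
... | j , inj₁ eq = j , inj₂ (cong suc eq)
... | j , inj₂ eq = suc j , inj₁ (cong suc (≡.trans eq (sym (ℕ.+-suc j j))))

log-double : ∀ j → ⌈log₂ (suc j ℕ.+ suc j) ⌉ ≡ 1 ℕ.+ ⌈log₂ (suc j) ⌉
log-double j = ≡.trans (cong (λ k → ⌈log₂ (suc j ℕ.+ k) ⌉) (sym (ℕ.+-identityʳ (suc j))))
    (⌈log₂2*n⌉≡1+⌈log₂n⌉ (suc j))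

-- Halving removes one bit and lowers the logarithm by one; for odd numbers monotonicity of the
-- logarithm makes up for the rounding.
length-binary-log : ∀ n → length (binary n) ℕ.≤ 1 ℕ.+ ⌈log₂ n ⌉
length-binary-log = <-rec _ step
  where
  step : ∀ n → (∀ {k} → k ℕ.< n → length (binary k) ℕ.≤ 1 ℕ.+ ⌈log₂ k ⌉) →
      length (binary n) ℕ.≤ 1 ℕ.+ ⌈log₂ n ⌉
  step n ih with parity n
  ... | zero  , inj₁ ≡.refl = z≤n
  ... | zero  , inj₂ ≡.refl = s≤s z≤n
  ... | suc j , inj₁ ≡.refl rewrite binary-even j | log-double j = s≤s (ih (ℕ.m<n+m (suc j) (s≤s z≤n)))
  ... | suc j , inj₂ ≡.refl rewrite binary-odd (suc j) = s≤s (begin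
      length (binary (suc j))       ≤⟨ ih (s≤s (ℕ.m≤n+m (suc j) (suc j))) ⟩
      1 ℕ.+ ⌈log₂ (suc j) ⌉          ≡⟨ log-double j ⟨
      ⌈log₂ (suc j ℕ.+ suc j) ⌉      ≤⟨ ⌈log₂⌉-mono-≤ (ℕ.n≤1+n (suc j ℕ.+ suc j)) ⟩
      ⌈log₂ (suc (suc j ℕ.+ suc j)) ⌉ ∎)
    where open ℕ.≤-Reasoning

-- The two length fields are bounded crudely by `length s` instead of its logarithm, which affects
-- only the constant factor.
length-selfDelimiting : ∀ s → length (selfDelimiting s) ℕ.≤ 1 ℕ.+ 3 ℕ.* length s
length-selfDelimiting s = begin
  length (selfDelimiting s)                                      ≡⟨ length-++
      (replicate (length b) true ++ false ∷ []) ⟩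
  length (replicate (length b) true ++ false ∷ []) ℕ.+ length (b ++ s)
    ≡⟨ cong₂ ℕ._+_ (≡.trans (length-++ (replicate (length b) true))
        (cong (ℕ._+ 1) (length-replicate (length b)))) (length-++ b) ⟩
  (length b ℕ.+ 1) ℕ.+ (length b ℕ.+ length s)                   ≤⟨ ℕ.+-mono-≤ (ℕ.+-monoˡ-≤ 1 b≤s)
      (ℕ.+-monoˡ-≤ (length s) b≤s) ⟩
  (length s ℕ.+ 1) ℕ.+ (length s ℕ.+ length s)                   ≡⟨ solve 1 (λ l →
      (l ⊕ κ 1) ⊕ (l ⊕ l) := κ 1 ⊕ κ 3 ⊛ l) ≡.refl (length s) ⟩
  1 ℕ.+ 3 ℕ.* length s                                           ∎
  where
  open ℕ.≤-Reasoning
  open ℕ.+-*-Solver using (solve; _:=_) renaming (con to κ; _:+_ to _⊕_; _:*_ to _⊛_)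
  b = binary (length s)
  b≤s = length-binary-≤ (length s)

length-oracle : ∀ m q → length (encodeℕ m ++ encodeℚ q) ℕ.≤ 3 ℕ.+ 3 ℕ.* (length (binary m) ℕ.+ ratBits q)
length-oracle m q = begin
  length (encodeℕ m ++ encodeℕ n ++ encodeℕ d)
    ≡⟨ ≡.trans (length-++ (encodeℕ m)) (cong (length (encodeℕ m) ℕ.+_) (length-++ (encodeℕ n))) ⟩
  length (encodeℕ m) ℕ.+ (length (encodeℕ n) ℕ.+ length (encodeℕ d))
    ≤⟨ ℕ.+-mono-≤ (length-selfDelimiting (binary m))
        (ℕ.+-mono-≤ (length-selfDelimiting (binary n)) (length-selfDelimiting (binary d))) ⟩
  (1 ℕ.+ 3 ℕ.* length (binary m)) ℕ.+ ((1 ℕ.+ 3 ℕ.* length (binary n)) ℕ.+ (1 ℕ.+ 3 ℕ.* length (binary d)))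
    ≡⟨ solve 3 (λ m n d → (κ 1 ⊕ κ 3 ⊛ m) ⊕ ((κ 1 ⊕ κ 3 ⊛ n) ⊕ (κ 1 ⊕ κ 3 ⊛ d)) := κ 3 ⊕ κ
        3 ⊛ (m ⊕ (n ⊕ d)))
         ≡.refl (length (binary m)) (length (binary n)) (length (binary d)) ⟩
  3 ℕ.+ 3 ℕ.* (length (binary m) ℕ.+ (length (binary n) ℕ.+ length (binary d))) ∎
  where
  open ℕ.≤-Reasoning
  open ℕ.+-*-Solver using (solve; _:=_) renaming (con to κ; _:+_ to _⊕_; _:*_ to _⊛_)
  n = ∣ ↥ q ∣
  d = ↧ₙ q

binary-suc-nonEmpty : ∀ n → 1 ℕ.≤ length (binary (suc n))
binary-suc-nonEmpty n = nonEmpty (binary n)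
  where
  nonEmpty : ∀ bs → 1 ℕ.≤ length (increment bs)
  nonEmpty []          = s≤s z≤n
  nonEmpty (false ∷ _) = s≤s z≤n
  nonEmpty (true ∷ _)  = s≤s z≤n

ratBits-≥2 : ∀ {v} → 0ℚ < v → 2 ℕ.≤ ratBits v
ratBits-≥2 {mkℚ (+ suc n) d _}  _                =
    ℕ.+-mono-≤ (binary-suc-nonEmpty n) (binary-suc-nonEmpty d)
ratBits-≥2 {mkℚ (+ zero) d _}   (*<* (ℤ.+<+ ()))
ratBits-≥2 {mkℚ -[1+ n ] d _}   (*<* ())

ratBits-≤ : ∀ {v σ} → v ∈ σ → ratBits v ℕ.≤ itemBits σ
ratBits-≤ {σ = σ} v∈ = All.lookup (xs≤max 0 (map ratBits σ)) (∈-map⁺ ratBits v∈)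

-- Two uses: the conventional `x_0 = 1`, not an item of `σ`, takes exactly 2 bits, and the additive
-- constants in the length of the advice are absorbed by `itemBits σ`.
itemBits-≥2 : ∀ {σ} → All IsSize σ → σ ≢ [] → 2 ℕ.≤ itemBits σ
itemBits-≥2 []                  ≢[] = contradiction ≡.refl ≢[]
itemBits-≥2 {v ∷ σ} ((0<v , _) ∷ _) _ = ℕ.≤-trans (ratBits-≥2 0<v) (ratBits-≤ {v} {v ∷ σ} (here ≡.refl))

bestM-≤ : ∀ k σ → bestM k σ ℕ.≤ length σ
bestM-≤ k σ = sel (argmax-sel (emulate k σ) 0 (upTo (suc (numberOf2Items σ))))
  where
  sel : ∀ {m} → m ≡ 0 ⊎ m ∈ upTo (suc (numberOf2Items σ)) → m ℕ.≤ length σ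
  sel (inj₁ ≡.refl) = z≤n
  sel (inj₂ m∈)     = ℕ.≤-trans (ℕ.≤-pred (∈-upTo⁻ m∈)) (numberOf2Items-≤ σ)

ratBits-largest : ∀ {σ m} → All IsSize σ → σ ≢ [] → m ℕ.≤ length σ → ratBits (largest σ m) ℕ.≤ itemBits σ
ratBits-largest {m = zero}  sizes ≢[] _  = itemBits-≥2 sizes ≢[]
ratBits-largest {σ} {suc i} sizes _   i< = ratBits-≤ {largest σ (suc i)} {σ} (largest-∈ σ i<)

largest-nonNeg : ∀ {σ m} → All IsSize σ → m ℕ.≤ length σ → 0ℚ ≤ largest σ m
largest-nonNeg {m = zero}  sizes _  = ≤!
largest-nonNeg {σ} {suc i} sizes i< = <⇒≤ (proj₁ (All.lookup sizes (largest-∈ σ i<)))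

-- Of the factor 9, three come from the self-delimiting code and six absorb its additive constant.
-- For an empty input the right-hand side would be 0, while the advice never is empty.
advice-length : ∀ {σ m} → All IsSize σ → σ ≢ [] → m ℕ.≤ length σ →
  length (encodeℕ m ++ encodeℚ (largest σ m)) ℕ.≤ 9 ℕ.* (itemBits σ ℕ.+ ⌈log₂ length σ ⌉)
advice-length {σ} {m} sizes ≢[] m≤ = begin
  length (encodeℕ m ++ encodeℚ (largest σ m))                 ≤⟨ length-oracle m (largest σ m) ⟩
  3 ℕ.+ 3 ℕ.* (length (binary m) ℕ.+ ratBits (largest σ m))   ≤⟨ ℕ.+-monoʳ-≤ 3 (ℕ.*-monoʳ-≤ 3 (ℕ.+-mono-≤
                                                                  (ℕ.≤-trans (length-binary-log m)
                                                                      (ℕ.+-monoʳ-≤ 1 (⌈log₂⌉-mono-≤ m≤)))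
                                                                  (ratBits-largest sizes ≢[] m≤))) ⟩
  3 ℕ.+ 3 ℕ.* (1 ℕ.+ l ℕ.+ b)                                 ≡⟨ solve 2 (λ l b →
      κ 3 ⊕ κ 3 ⊛ (κ 1 ⊕ l ⊕ b) := κ 6 ⊛ κ 1 ⊕ (κ 3 ⊛ b ⊕ κ 3 ⊛ l)) ≡.refl l b ⟩
  6 ℕ.* 1 ℕ.+ (3 ℕ.* b ℕ.+ 3 ℕ.* l)                           ≤⟨ ℕ.+-mono-≤
      (ℕ.*-monoʳ-≤ 6 (ℕ.≤-trans (s≤s z≤n) (itemBits-≥2 sizes ≢[])))
      (ℕ.+-monoʳ-≤ (3 ℕ.* b) (ℕ.*-monoˡ-≤ l (ℕ.m≤m+n 3 6))) ⟩
  6 ℕ.* b ℕ.+ (3 ℕ.* b ℕ.+ 9 ℕ.* l)                           ≡⟨ solve 2 (λ l b →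
      κ 6 ⊛ b ⊕ (κ 3 ⊛ b ⊕ κ 9 ⊛ l) := κ 9 ⊛ (b ⊕ l)) ≡.refl l b ⟩
  9 ℕ.* (b ℕ.+ l)                                             ∎
  where
  open ℕ.≤-Reasoning
  open ℕ.+-*-Solver using (solve; _:=_) renaming (con to κ; _:+_ to _⊕_; _:*_ to _⊛_)
  b = itemBits σ
  l = ⌈log₂ length σ ⌉

-- Executing the strategy on the oracle's tape

readAdvice : ∀ {m x} rest → 0ℚ ≤ x →
  AdviceStrategy.start (DH 4) ((encodeℕ m ++ encodeℚ x) ++ rest) ≡ just (initial m x , rest)
readAdvice {m} {x} rest 0≤x = ≡.trans
  (>>=-just readℕ _ ((encodeℕ m ++ encodeℚ x) ++ rest) {m} {encodeℚ x ++ rest}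
    (≡.trans (cong readℕ (++-assoc (encodeℕ m) (encodeℚ x) rest)) (readℕ-++ m (encodeℚ x ++ rest))))
  (>>=-just readℚ (λ x → return (initial m x)) (encodeℚ x ++ rest) (readℚ-++ x rest 0≤x))

execute-start : ∀ S {tape σ s rest} → AdviceStrategy.start S tape ≡ just (s , rest) →
  execute S tape σ ≡ just (record
    { bitsRead    = length tape ℕ.∸ length rest
    ; coveredBins = covered (AdviceStrategy._≟_ S) (AdviceStrategy.pack S s σ) })
execute-start S eq = cong (Maybe.map _) eq

-- Whatever `rest` follows on the tape, the self-delimiting code tells the reader where to stop, so
-- the bits read are exactly those of the advice.
execute-DH : ∀ m x σ rest → 0ℚ ≤ x →
  execute (DH 4) ((encodeℕ m ++ encodeℚ x) ++ rest) σ ≡ just (record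
    { bitsRead    = length (encodeℕ m ++ encodeℚ x)
    ; coveredBins = covered _≟ᴮ_ (packᴰ (initial m x) σ) })
execute-DH m x σ rest 0≤x = ≡.trans
  (execute-start (DH 4) {advice ++ rest} {σ} {initial m x} {rest} (readAdvice rest 0≤x))
  (cong (λ b → just (record { bitsRead = b ; coveredBins = covered _≟ᴮ_ (packᴰ (initial m x) σ) }))
    (≡.trans (cong (ℕ._∸ length rest) (length-++ advice)) (ℕ.m+n∸n≡m (length advice) (length rest))))
  where advice = encodeℕ m ++ encodeℚ x

theorem2 : ∃[ c ] ((σ : List ℚ) → All IsSize σ → (rest : Bits) →
    ∃[ r ] (execute (DH 4) (oracle 4 σ ++ rest) σ ≡ just r
    × (σ ≢ [] → Outcome.bitsRead r ≤ℕ c *ℕ (itemBits σ +ℕ ⌈log₂ length σ ⌉))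
    × (+ 2 / 3) * (+ OPT σ / 1) - (+ 173 / 60) ≤ (+ Outcome.coveredBins r / 1)))
theorem2 = 9 , λ σ sizes rest →
  record { bitsRead = length (oracle 4 σ) ; coveredBins = emulate 4 σ (bestM 4 σ) } ,
  execute-DH (bestM 4 σ) (largest σ (bestM 4 σ)) σ rest
      (largest-nonNeg {σ} {bestM 4 σ} sizes (bestM-≤ 4 σ)) ,
  (λ σ≢[] → advice-length {σ} {bestM 4 σ} sizes σ≢[] (bestM-≤ 4 σ)) ,
  subst₂ (λ o c → ⅔ * o - + 173 / 60 ≤ c)
    (ι-def (OPT σ)) (ι-def (emulate 4 σ (bestM 4 σ))) (competitive {σ} sizes)
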